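{- For every weighted digraph $\Gamma$ with Kirchhoff matrix $L$ and normalized matrix of maximum out forests $\bar J$, and for any real $\alpha\neq 0$, the group inverse $L^{\#}$ of $L$ exists and is given by $$L^{\#}=(L+\alpha\bar J)^{ -1}-\alpha^{ -1}\bar J,$$ and moreover $$L^{\#}L=LL^{\#}=I-\bar J.$$
   Context: $\Gamma$ is a weighted digraph without loops with vertex set $\{1,\dots,n\}$, $n>1$; all arcs have strictly positive real weights; $\varepsilon_{ij}$ denotes the weight of the arc from $i$ to $j$, with $\varepsilon_{ij}=0$ if and only if there is no such arc. The Kirchhoff matrix $L=(\ell_{ij})$ is the $n\times n$ matrix with $\ell_{ij}=-\varepsilon_{ji}$ for $j\ne i$ and $\ell_{ii}=-\sum_{k\ne i}\ell_{ik}$. A diverging forest is a digraph without (directed) circuits in which every vertex has indegree at most 1; its weak components are diverging trees, each having a unique vertex of indegree 0 (its root) from which all vertices of the tree are reachable. An out forest of $\Gamma$ is a spanning subgraph of $\Gamma$ that is a diverging forest; a maximum out forest is an out forest with the greatest possible number of arcs. The out forest dimension $v$ is the number of weak components of any maximum out forest, so maximum out forests have $n-v$ arcs. The weight of a subgraph is the product of the weights of its arcs (1 if it has no arcs); the weight $\varepsilon(\mathcal G)$ of a set of subgraphs is the sum of the weights of its elements (0 for the empty set). The normalized matrix of maximum out forests is $\bar J=(\bar J_{ij})$ with $\bar J_{ij}=\varepsilon(\mathcal F_{n-v}^{j\to i})/\varepsilon(\mathcal F_{n-v})$, where $\mathcal F_{n-v}$ is the set of maximum out forests and $\mathcal F_{n-v}^{j\to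 i}$ is the set of those in which $i$ belongs to a tree with root $j$. The group inverse of a square matrix $A$ is the (unique if it exists) matrix $X=A^{\#}$ such that $AXA=A$, $XAX=X$ and $AX=XA$. -}

module Defs where

open import Algebra.Apartness.Bundles using (HeytingCommutativeRing; HeytingField)
open import Algebra.Bundles using (CommutativeRing)
import Algebra.Definitions as AlgebraDefinitions
import Algebra.Properties.Monoid.Sum as MonoidSum
import Algebra.Properties.Ring as RingProperties
open import Data.Bool.Base using (true; false; if_then_else_)
open import Data.Empty using (⊥-elim)
open import Data.Fin.Base using (Fin; zero; suc)
open import Data.Fin.Properties using (_≟_; all?; any?)
open import Data.Fin.Subset as Subset using (Subset; ∣_∣; _∈_; _⊆_)
open import Data.Fin.Subset.Properties using (_∈?_; _⊆?_; ∉⊥; ∣⊥∣≡0)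
open import Data.List.Base as List using (List; []; _∷_)
import Data.List.Extrema
open import Data.List.Membership.Propositional using () renaming (_∈_ to _∈ˡ_)
import Data.List.Membership.Propositional.Properties as ∈ˡ
open import Data.List.Relation.Unary.All as All using (All; []; _∷_)
import Data.List.Relation.Unary.All.Properties as Allₚ
import Data.List.Relation.Unary.AllPairs as AllPairs
open import Data.List.Relation.Unary.Any using (here; there)
open import Data.List.Relation.Unary.Unique.Propositional using (Unique)
import Data.List.Relation.Unary.Unique.Propositional.Properties as Uniqueₚ
open import Data.Nat.Base as ℕ using (ℕ; zero; suc)
import Data.Nat.Properties as ℕₚ
open import Data.Product.Base using (∃; _×_; _,_; proj₁; proj₂)
open import Data.Sum.Base using (_⊎_; inj₁; inj₂)
open import Data.Vec.Base as Vec using (Vec; []; _∷_; lookup)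
import Data.Vec.Properties as Vecₚ
import Data.Vec.Functional as Vector
open import Function.Base using (_∘_)
open import Level using (0ℓ; _⊔_) renaming (suc to lsuc)
open import Relation.Binary.Construct.Closure.Equivalence using (EqClosure)
open import Relation.Binary.Construct.Closure.ReflexiveTransitive
  using (Star; ε; _◅_; _◅◅_)
open import Relation.Binary.Construct.Closure.Symmetric using (fwd; bwd)
open import Relation.Binary.Construct.Closure.Transitive
  using (TransClosure; [_]; _∷_)
open import Relation.Binary.Core using (Rel)
open import Relation.Binary.Definitions using (Decidable)
open import Relation.Binary.PropositionalEquality as ≡ using (_≡_)
open import Relation.Binary.Structures using (IsStrictPartialOrder)
open import Relation.Nullary using (yes; no; does; ¬_; ¬?)
open import Relation.Nullary.Decidable using (map′; _×-dec_; _⊎-dec_; _→-dec_)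
import Relation.Unary as U

-- The scalars are an arbitrary ordered field whose apartness is the one
-- induced by the order.  No decidability is assumed, so that the real
-- numbers are an instance constructively as well as classically; over the
-- classical reals x # y is just x ≠ y.

record OrderedField c ℓ₁ ℓ₂ ℓ₃ : Set (lsuc (c ⊔ ℓ₁ ⊔ ℓ₂ ⊔ ℓ₃)) where
  infix 4 _<_
  field
    heytingField : HeytingField c ℓ₁ ℓ₂

  open HeytingField heytingField public hiding (zero)

  field
    _<_                    : Rel Carrier ℓ₃
    <-isStrictPartialOrder : IsStrictPartialOrder _≈_ _<_
    #⇒<⊎>                  : ∀ {x y} → x # y → x < y ⊎ y < x
    <⇒#                    : ∀ {x y} → x < y → x # y
    +-monoʳ-<              : ∀ z {x y} → x < y → z + x < z + y
    *-pos                  : ∀ {x y} → 0# < x → 0# < y → 0# < x * y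

  open IsStrictPartialOrder <-isStrictPartialOrder public
    using (<-respʳ-≈; <-respˡ-≈) renaming (trans to <-trans; irrefl to <-irrefl)

  open HeytingCommutativeRing heytingCommutativeRing public using (commutativeRing)

  private
    module R = CommutativeRing commutativeRing
    module Rₚ = RingProperties R.ring

  ∑ ∏ : ∀ {n} → Vector.Vector Carrier n → Carrier
  ∑ = MonoidSum.sum R.+-monoid
  ∏ = MonoidSum.sum R.*-monoid

  ∑ˡ : List Carrier → Carrier
  ∑ˡ = List.foldr _+_ 0#

  x-0≈x : ∀ x → x - 0# ≈ x
  x-0≈x x = trans (+-congˡ Rₚ.-0#≈0#) (+-identityʳ x)

  -- #⇒invertible inverts x - 0# rather than x itself; see recip-inverseʳ.
  recip : ∀ x → x # 0# → Carrier
  recip x x#0 = proj₁ (#⇒invertible x#0)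

  recip-inverseʳ : ∀ x (x#0 : x # 0#) → x * recip x x#0 ≈ 1#
  recip-inverseʳ x x#0 =
    trans (*-congʳ (sym (x-0≈x x))) (proj₂ (proj₂ (#⇒invertible x#0)))

  pos⇒#0 : ∀ {x} → 0# < x → x # 0#
  pos⇒#0 = #-sym ∘ <⇒#

  0<1 : 0# < 1#
  0<1 with #⇒<⊎> (invertible⇒# (1# , eq , trans (*-comm _ _) eq))
    where
    eq : 1# * (1# - 0#) ≈ 1#
    eq = trans (*-identityˡ _) (x-0≈x 1#)
  ... | inj₂ 0<1 = 0<1
  ... | inj₁ 1<0 = <-respʳ-≈ -1*-1≈1 (*-pos 0<-1 0<-1)
    where
    0<-1 : 0# < - 1#
    0<-1 = <-respʳ-≈ (+-identityʳ _) (<-respˡ-≈ (-‿inverseˡ 1#) (+-monoʳ-< (- 1#) 1<0))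
    -1*-1≈1 : - 1# * - 1# ≈ 1#
    -1*-1≈1 = trans (Rₚ.-1*x≈-x (- 1#)) (Rₚ.-‿involutive 1#)

  +-pos : ∀ {x y} → 0# < x → 0# < y → 0# < x + y
  +-pos {x} 0<x 0<y = <-trans 0<x (<-respˡ-≈ (+-identityʳ x) (+-monoʳ-< x 0<y))

  ∏-pos : ∀ {n} (f : Fin n → Carrier) → (∀ i → 0# < f i) → 0# < ∏ f
  ∏-pos {zero}  f 0<f = 0<1
  ∏-pos {suc n} f 0<f = *-pos (0<f zero) (∏-pos (f ∘ suc) (0<f ∘ suc))

  ∑ˡ-pos : ∀ {x} {xs : List Carrier} → x ∈ˡ xs → All (0# <_) xs → 0# < ∑ˡ xs
  ∑ˡ-pos {xs = x ∷ []}     _ (0<x ∷ [])   = <-respʳ-≈ (sym (+-identityʳ x)) 0<x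
  ∑ˡ-pos {xs = x ∷ y ∷ ys} _ (0<x ∷ 0<ys) = +-pos 0<x (∑ˡ-pos (here ≡.refl) 0<ys)

private
  module Reachability {ℓ} {n} {R : Rel (Fin n) ℓ} (R? : Decidable R) where

    -- Via zs x y: there is a walk from x to y of which all intermediate
    -- vertices belong to zs.
    Via : List (Fin n) → Rel (Fin n) ℓ
    Via []       x y = x ≡ y ⊎ R x y
    Via (z ∷ zs) x y = Via zs x y ⊎ (Via zs x z × Via zs z y)

    via? : ∀ zs → Decidable (Via zs)
    via? []       x y = (x ≟ y) ⊎-dec R? x y
    via? (z ∷ zs) x y = via? zs x y ⊎-dec (via? zs x z ×-dec via? zs z y)

    lift : ∀ zs {x y} → x ≡ y ⊎ R x y → Via zs x y
    lift []       p = p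
    lift (z ∷ zs) p = inj₁ (lift zs p)

    join : ∀ {zs w x y} → w ∈ˡ zs → Via zs x w → Via zs w y → Via zs x y
    join (here ≡.refl) p q = inj₂ (to p , from q)
      where
      to : ∀ {A B : Set ℓ} → A ⊎ (A × B) → A
      to (inj₁ a)       = a
      to (inj₂ (a , _)) = a
      from : ∀ {A B : Set ℓ} → A ⊎ (B × A) → A
      from (inj₁ a)       = a
      from (inj₂ (_ , a)) = a
    join (there w∈) (inj₁ p)       (inj₁ q)       = inj₁ (join w∈ p q)
    join (there w∈) (inj₁ p)       (inj₂ (q , r)) = inj₂ (join w∈ p q , r)
    join (there w∈) (inj₂ (p , q)) (inj₁ r)       = inj₂ (p , join w∈ q r)
    join (there w∈) (inj₂ (p , _)) (inj₂ (_ , r)) = inj₂ (p , r)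

    via⇒star : ∀ zs {x y} → Via zs x y → Star R x y
    via⇒star []       (inj₁ ≡.refl)  = ε
    via⇒star []       (inj₂ r)       = r ◅ ε
    via⇒star (z ∷ zs) (inj₁ p)       = via⇒star zs p
    via⇒star (z ∷ zs) (inj₂ (p , q)) = via⇒star zs p ◅◅ via⇒star zs q

    star⇒via : ∀ {x y} → Star R x y → Via (List.allFin n) x y
    star⇒via ε        = lift (List.allFin n) (inj₁ ≡.refl)
    star⇒via (r ◅ rs) =
      join (∈ˡ.∈-allFin _) (lift (List.allFin n) (inj₂ r)) (star⇒via rs)

star? : ∀ {ℓ n} {R : Rel (Fin n) ℓ} → Decidable R → Decidable (Star R)
star? {n = n} R? x y = map′ (via⇒star (List.allFin n)) star⇒via (via? (List.allFin n) x y)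
  where open Reachability R?

plus? : ∀ {ℓ n} {R : Rel (Fin n) ℓ} → Decidable R → Decidable (TransClosure R)
plus? {R = R} R? x y = map′ to from (any? λ z → R? x z ×-dec star? R? z y)
  where
  cons : ∀ {x z y} → R x z → Star R z y → TransClosure R x y
  cons r ε        = [ r ]
  cons r (s ◅ ss) = r ∷ cons s ss
  to : ∀ {x y} → ∃ (λ z → R x z × Star R z y) → TransClosure R x y
  to (_ , r , rs) = cons r rs
  from : ∀ {x y} → TransClosure R x y → ∃ (λ z → R x z × Star R z y)
  from [ r ]    = _ , r , ε
  from (r ∷ rs) with from rs
  ... | _ , s , ss = _ , r , s ◅ ss

eqClosure? : ∀ {ℓ n} {R : Rel (Fin n) ℓ} → Decidable R → Decidable (EqClosure R)
eqClosure? R? = star? λ x y →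
  map′ (λ { (inj₁ r) → fwd r ; (inj₂ r) → bwd r })
       (λ { (fwd r) → inj₁ r ; (bwd r) → inj₂ r })
       (R? x y ⊎-dec R? y x)

-- The j-th entry is the set of tails of the arcs entering j.

Digraph : ℕ → Set
Digraph n = Vec (Subset n) n

module _ {n : ℕ} where

  Arc : Digraph n → Rel (Fin n) 0ℓ
  Arc G i j = i ∈ lookup G j

  arc? : ∀ G → Decidable (Arc G)
  arc? G i j = i ∈? lookup G j

  indegree : Digraph n → Fin n → ℕ
  indegree G j = ∣ lookup G j ∣

  numArcs : Digraph n → ℕ
  numArcs G = Vec.sum (Vec.map ∣_∣ G)

  -- Spanning: all digraphs here have the whole of Fin n as vertex set.
  Subgraph : Rel (Digraph n) 0ℓ
  Subgraph G D = ∀ j → lookup G j ⊆ lookup D j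

  Acyclic : Digraph n → Set
  Acyclic G = ∀ i → ¬ TransClosure (Arc G) i i

  IsDivergingForest : Digraph n → Set
  IsDivergingForest G = Acyclic G × (∀ j → indegree G j ℕ.≤ 1)

  WeaklyConnected : Digraph n → Rel (Fin n) 0ℓ
  WeaklyConnected G = EqClosure (Arc G)

  IsRoot : Digraph n → Fin n → Set
  IsRoot G j = indegree G j ≡ 0

  -- Trees of a diverging forest are its weak components, and the root of a
  -- tree is its unique vertex of indegree 0.
  InTreeRootedAt : Digraph n → (i j : Fin n) → Set
  InTreeRootedAt G i j = IsRoot G j × WeaklyConnected G j i

  IsOutForest : (D G : Digraph n) → Set
  IsOutForest D G = Subgraph G D × IsDivergingForest G

  IsMaximumOutForest : (D G : Digraph n) → Set
  IsMaximumOutForest D G =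
    IsOutForest D G × (∀ G′ → IsOutForest D G′ → numArcs G′ ℕ.≤ numArcs G)

  inTreeRootedAt? : ∀ i j → U.Decidable (λ G → InTreeRootedAt G i j)
  inTreeRootedAt? i j G =
    (indegree G j ℕₚ.≟ 0) ×-dec eqClosure? (arc? G) j i

  isOutForest? : ∀ D → U.Decidable (IsOutForest D)
  isOutForest? D G =
    all? (λ j → lookup G j ⊆? lookup D j) ×-dec
    (all? (λ i → ¬? (plus? (arc? G) i i)) ×-dec
     all? (λ j → indegree G j ℕₚ.≤? 1))

module _ {a} {A : Set a} where

  vectors : List A → ∀ n → List (Vec A n)
  vectors xs zero    = [] ∷ []
  vectors xs (suc n) = List.cartesianProductWith _∷_ xs (vectors xs n)

  vectors-complete : ∀ {xs} → (∀ x → x ∈ˡ xs) → ∀ {n} (v : Vec A n) → v ∈ˡ vectors xs n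
  vectors-complete all []      = here ≡.refl
  vectors-complete all (x ∷ v) =
    ∈ˡ.∈-cartesianProductWith⁺ _∷_ (all x) (vectors-complete all v)

  vectors-unique : ∀ {xs} → Unique xs → ∀ n → Unique (vectors xs n)
  vectors-unique xs! zero    = [] AllPairs.∷ AllPairs.[]
  vectors-unique xs! (suc n) =
    Uniqueₚ.cartesianProductWith⁺ _∷_ Vecₚ.∷-injective xs! (vectors-unique xs! n)

subsets : ∀ n → List (Subset n)
subsets = vectors (true ∷ false ∷ [])

digraphs : ∀ n → List (Digraph n)
digraphs n = vectors (subsets n) n

digraphs-complete : ∀ {n} (G : Digraph n) → G ∈ˡ digraphs n
digraphs-complete = vectors-complete (vectors-complete λ
  { true → here ≡.refl ; false → there (here ≡.refl) })

digraphs-unique : ∀ n → Unique (digraphs n)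
digraphs-unique n = vectors-unique (vectors-unique
  (((λ ()) ∷ []) AllPairs.∷ ([] AllPairs.∷ AllPairs.[])) n) n

module _ {n : ℕ} (D : Digraph n) where

  isMaximumOutForest? : U.Decidable (IsMaximumOutForest D)
  isMaximumOutForest? G = isOutForest? D G ×-dec
    map′ (λ ps G′ → All.lookup ps (digraphs-complete G′)) (λ p → All.tabulate λ {G′} _ → p G′)
      (All.all? (λ G′ → isOutForest? D G′ →-dec (numArcs G′ ℕₚ.≤? numArcs G)) (digraphs n))

  maximumOutForests : List (Digraph n)
  maximumOutForests = List.filter isMaximumOutForest? (digraphs n)

  maximumOutForestsRootedAt : (i j : Fin n) → List (Digraph n)
  maximumOutForestsRootedAt i j = List.filter (inTreeRootedAt? i j) maximumOutForests

  private
    ∅ : Digraph n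
    ∅ = Vec.replicate n Subset.⊥

    ∅-noArc : ∀ {i} j → ¬ Arc ∅ i j
    ∅-noArc j i∈ = ∉⊥ (≡.subst (_ ∈_) (Vecₚ.lookup-replicate j Subset.⊥) i∈)

    ∅-acyclic : ∀ {i j} → ¬ TransClosure (Arc ∅) i j
    ∅-acyclic [ r ]   = ∅-noArc _ r
    ∅-acyclic (r ∷ _) = ∅-noArc _ r

    ∅-indegree : ∀ j → indegree ∅ j ≡ 0
    ∅-indegree j = ≡.trans (≡.cong ∣_∣ (Vecₚ.lookup-replicate j Subset.⊥)) (∣⊥∣≡0 n)

    ∅-isOutForest : IsOutForest D ∅
    ∅-isOutForest = (λ j i∈ → ⊥-elim (∅-noArc j i∈)) , (λ _ → ∅-acyclic) ,
      (λ j → ≡.subst (ℕ._≤ 1) (≡.sym (∅-indegree j)) ℕ.z≤n)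

  maximumOutForest-exists : ∃ λ G → G ∈ˡ maximumOutForests
  maximumOutForest-exists = G₀ , ∈ˡ.∈-filter⁺ isMaximumOutForest? (digraphs-complete G₀)
    ( argmax-all numArcs ∅-isOutForest (Allₚ.all-filter (isOutForest? D) (digraphs n))
    , λ G′ p → All.lookup (f[xs]≤f[argmax] {f = numArcs} ∅ forests)
                 (∈ˡ.∈-filter⁺ (isOutForest? D) (digraphs-complete G′) p))
    where
    open Data.List.Extrema ℕₚ.≤-totalOrder using (argmax; argmax-all; f[xs]≤f[argmax])
    forests = List.filter (isOutForest? D) (digraphs n)
    G₀ = argmax numArcs ∅ forests

module Matrices {c ℓ₁ ℓ₂ ℓ₃} (F : OrderedField c ℓ₁ ℓ₂ ℓ₃) where
  open OrderedField F

  Matrix : ℕ → Set c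
  Matrix n = Fin n → Fin n → Carrier

  module _ {n : ℕ} where

    infix  4 _≋_
    infixl 6 _⊕_ _⊖_
    infixl 7 _⊛_
    infixr 7 _·_

    _≋_ : Rel (Matrix n) ℓ₁
    A ≋ B = ∀ i j → A i j ≈ B i j

    _⊕_ _⊖_ _⊛_ : Matrix n → Matrix n → Matrix n
    (A ⊕ B) i j = A i j + B i j
    (A ⊖ B) i j = A i j - B i j
    (A ⊛ B) i j = ∑ λ k → A i k * B k j

    _·_ : Carrier → Matrix n → Matrix n
    (x · A) i j = x * A i j

    𝟙 : Matrix n
    𝟙 i j = if does (i ≟ j) then 1# else 0#

    Invertible : Matrix n → Set (c ⊔ ℓ₁)
    Invertible = AlgebraDefinitions.Invertible _≋_ 𝟙 _⊛_

    record IsGroupInverse (A X : Matrix n) : Set ℓ₁ where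
      field
        AXA≋A : A ⊛ X ⊛ A ≋ A
        XAX≋X : X ⊛ A ⊛ X ≋ X
        AX≋XA : A ⊛ X ≋ X ⊛ A

record WeightedDigraph {c ℓ₁ ℓ₂ ℓ₃} (F : OrderedField c ℓ₁ ℓ₂ ℓ₃) (n : ℕ)
       : Set (c ⊔ ℓ₁ ⊔ ℓ₃) where
  open OrderedField F
  field
    digraph    : Digraph n
    loopless   : ∀ i → ¬ Arc digraph i i
    weight     : Fin n → Fin n → Carrier
    weight-pos : ∀ {i j} → Arc digraph i j → 0# < weight i j
    weight-0   : ∀ {i j} → ¬ Arc digraph i j → weight i j ≈ 0#

module _ {c ℓ₁ ℓ₂ ℓ₃} {F : OrderedField c ℓ₁ ℓ₂ ℓ₃} {n : ℕ} (Γ : WeightedDigraph F n) where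
  open OrderedField F
  open Matrices F
  open WeightedDigraph Γ

  kirchhoff : Matrix n
  kirchhoff i j =
    if does (i ≟ j)
    then - (∑ λ k → if does (i ≟ k) then 0# else - weight k i)
    else - weight j i

  subgraphWeight : Digraph n → Carrier
  subgraphWeight G = ∏ λ i → ∏ λ j → if does (arc? G i j) then weight i j else 1#

  totalWeight : List (Digraph n) → Carrier
  totalWeight Gs = ∑ˡ (List.map subgraphWeight Gs)

  subgraphWeight-pos : ∀ G → Subgraph G digraph → 0# < subgraphWeight G
  subgraphWeight-pos G G⊆Γ = ∏-pos _ λ i → ∏-pos _ λ j → factor-pos i j
    where
    factor-pos : ∀ i j → 0# < (if does (arc? G i j) then weight i j else 1#)
    factor-pos i j with arc? G i j
    ... | yes i→j = weight-pos (G⊆Γ j i→j)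
    ... | no  _   = 0<1

  maximumOutForests-weight-pos : 0# < totalWeight (maximumOutForests digraph)
  maximumOutForests-weight-pos =
    ∑ˡ-pos (∈ˡ.∈-map⁺ subgraphWeight (proj₂ (maximumOutForest-exists digraph)))
      (Allₚ.map⁺ (All.map (λ {G} ((G⊆Γ , _) , _) → subgraphWeight-pos G G⊆Γ)
        (Allₚ.all-filter (isMaximumOutForest? digraph) (digraphs n))))

  J̄ : Matrix n
  J̄ i j = totalWeight (maximumOutForestsRootedAt digraph i j)
        * recip (totalWeight (maximumOutForests digraph))
                (pos⇒#0 maximumOutForests-weight-pos)

{-# OPTIONS --safe #-}

-- Let Q_k be the matrix whose (i, j) entry is the weight of the out forests with
-- k arcs in which i belongs to the tree rooted at j, and σ_k the weight of all
-- out forests with k arcs.  Splitting every out forest according to the arc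
-- entering i (if any) gives the recurrence Q_{k+1} + L Q_k = σ_{k+1} I.  Hence
-- every Q_k is a polynomial in L.  For the maximal number K of arcs,
-- Q_{K+1} = 0 and σ_{K+1} = 0, so L Q_K = 0; and Q_K + L Q_{K-1} = σ_K I says
-- that L Y + J̄ = I for Y = Q_{K-1} / σ_K, which commutes with L.  From these
-- relations Y L Y is the group inverse of L, and Y L Y + α⁻¹ J̄ inverts L + α J̄.
module Submission where

open import Defs
open import Algebra.Bundles using (CommutativeMonoid; CommutativeRing; Ring)
import Algebra.Properties.CommutativeMonoid.Sum as CommutativeMonoidSum
import Algebra.Properties.Ring as RingProperties
import Algebra.Properties.Semiring.Sum as SemiringSum
import Algebra.Solver.Ring.NaturalCoefficients.Default as RingSolver
open import Data.Bool.Base using (true; false; if_then_else_)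
open import Data.Empty using (⊥-elim)
open import Data.Fin.Base using (Fin; zero; suc)
open import Data.Fin.Properties using (_≟_)
open import Data.Fin.Subset as Subset using (Subset; ∣_∣; _∈_; ⁅_⁆)
open import Data.Fin.Subset.Properties using (∉⊥; ∣⊥∣≡0; ∣⁅x⁆∣≡1; x∈⁅x⁆; x∈⁅y⁆⇒x≡y)
open import Data.List.Base as List using (List; []; _∷_; _++_)
open import Data.List.Membership.Propositional.Properties using (∈-filter⁻)
open import Data.Nat.Base as ℕ using (ℕ; zero; suc)
import Data.Nat.Properties as ℕₚ
open import Data.Product.Base using (∃; Σ-syntax; _×_; _,_; proj₁; proj₂)
open import Data.Sum.Base as Sum using (_⊎_; inj₁; inj₂)
open import Data.Vec.Base as Vec using (Vec; []; _∷_; lookup; _[_]≔_)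
import Data.Vec.Properties as Vecₚ
open import Function.Base using (_∘_; flip; id)
open import Level using (0ℓ)
open import Relation.Binary.Construct.Closure.ReflexiveTransitive as Star
  using (Star; ε; _◅_; _◅◅_)
open import Relation.Binary.Construct.Closure.Symmetric using (fwd; bwd)
open import Relation.Binary.Construct.Closure.Transitive
  using (TransClosure; [_]; _∷_)
open import Relation.Binary.Core using (Rel)
open import Relation.Binary.PropositionalEquality as ≡ using (_≡_; _≢_)
open import Relation.Nullary using (Dec; yes; no; does; ¬_; ¬?)
open import Relation.Nullary.Decidable using (dec-true; dec-false)
import Relation.Unary as U

-- Diverging forests and the insertion of an arc

-- Every quantity in the recurrence is rewritten as a sum over the out forests `G` in which `i` is a
-- root, and the identity is then checked for each `G` separately. The weight of all arcs of Γ
-- entering `i` splits into that of the arcs which may be inserted into `G` and that of the arcs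
-- whose tail lies in the tree of `i` and which would close a circuit; this splitting drives the
-- recurrence. No argument by rank or determinant is used, as the scalars need not have decidable
-- equality: the only divisions are by σ_K, which is positive, and by α.

∣p∣≡0⇒x∉p : ∀ {n} {p : Subset n} → ∣ p ∣ ≡ 0 → ∀ x → ¬ x ∈ p
∣p∣≡0⇒x∉p {p = false ∷ p} eq (suc x) (Vec.there x∈p) = ∣p∣≡0⇒x∉p eq x x∈p

∣p∣≤1⇒x≡y : ∀ {n} {p : Subset n} → ∣ p ∣ ℕ.≤ 1 → ∀ {x y} → x ∈ p → y ∈ p → x ≡ y
∣p∣≤1⇒x≡y {p = true ∷ p}  _           Vec.here      Vec.here      = ≡.refl
∣p∣≤1⇒x≡y {p = true ∷ p}  (ℕ.s≤s p≤0) Vec.here      (Vec.there y) = ⊥-elim (∣p∣≡0⇒x∉p (ℕₚ.n≤0⇒n≡0 p≤0) _ y)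
∣p∣≤1⇒x≡y {p = true ∷ p}  (ℕ.s≤s p≤0) (Vec.there x) _             = ⊥-elim (∣p∣≡0⇒x∉p (ℕₚ.n≤0⇒n≡0 p≤0) _ x)
∣p∣≤1⇒x≡y {p = false ∷ p} p≤1         (Vec.there x) (Vec.there y) = ≡.cong suc (∣p∣≤1⇒x≡y p≤1 x y)

module _ {n : ℕ} where

  -- In a diverging forest the walk up along the arcs is deterministic, so
  -- trees are best described by climbing from a vertex to its root.
  Climb : Digraph n → Rel (Fin n) 0ℓ
  Climb G = Star (flip (Arc G))

  Functional : Digraph n → Set
  Functional G = ∀ j → indegree G j ℕ.≤ 1

  climb⇒connected : ∀ G {x j} → Climb G x j → WeaklyConnected G j x
  climb⇒connected G ε        = ε
  climb⇒connected G (r ◅ rs) = climb⇒connected G rs ◅◅ fwd r ◅ ε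

  -- The path is followed from the root, keeping a climb from the current vertex to `j`. A forward
  -- arc lengthens that climb; a backward arc must undo its first step, because only one arc enters
  -- the vertex, and cannot occur at the root.
  connected⇒climb : ∀ G {x j} → Functional G → IsRoot G j → WeaklyConnected G j x → Climb G x j
  connected⇒climb G {x} {j} f root = go ε
    where
    go : ∀ {y} → Climb G y j → WeaklyConnected G y x → Climb G x j
    go p        ε            = p
    go p        (fwd r ◅ rs) = go (r ◅ p) rs
    go ε        (bwd r ◅ rs) = ⊥-elim (∣p∣≡0⇒x∉p root _ r)
    go (s ◅ p)  (bwd r ◅ rs) with ≡.refl ← ∣p∣≤1⇒x≡y (f _) s r = go p rs

  inTree⇒climb : ∀ G {x j} → Functional G → InTreeRootedAt G x j → Climb G x j
  inTree⇒climb G f (root , c) = connected⇒climb G f root c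

  inTree-unique : ∀ G {x j k} → Functional G → InTreeRootedAt G x j → InTreeRootedAt G x k → j ≡ k
  inTree-unique G {x} {j} {k} f (rootⱼ , cⱼ) (rootₖ , cₖ) =
    go (connected⇒climb G f rootⱼ cⱼ) (connected⇒climb G f rootₖ cₖ)
    where
    go : ∀ {y} → Climb G y j → Climb G y k → j ≡ k
    go ε       ε       = ≡.refl
    go ε       (r ◅ _) = ⊥-elim (∣p∣≡0⇒x∉p rootⱼ _ r)
    go (r ◅ _) ε       = ⊥-elim (∣p∣≡0⇒x∉p rootₖ _ r)
    go (r ◅ p) (s ◅ q) with ≡.refl ← ∣p∣≤1⇒x≡y (f _) r s = go p q

  -- With `z` equal to `y`, this and `cycle⇒climb` identify a circuit through `y` with an arc
  -- entering `y` whose tail climbs back to `y`, so that acyclicity can be checked on climbs.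
  climb⇒cycle : ∀ G {x y z} → Arc G x y → Climb G x z → TransClosure (Arc G) z y
  climb⇒cycle G r ε       = [ r ]
  climb⇒cycle G r (s ◅ p) = snoc (climb⇒cycle G s p) r
    where
    snoc : ∀ {a b c} → TransClosure (Arc G) a b → Arc G b c → TransClosure (Arc G) a c
    snoc [ s ]   r = s ∷ [ r ]
    snoc (s ∷ p) r = s ∷ snoc p r

  cycle⇒climb : ∀ G {y z} → TransClosure (Arc G) z y → ∃ λ x → Arc G x y × Climb G x z
  cycle⇒climb G [ r ]   = _ , r , ε
  cycle⇒climb G (r ∷ p) with _ , s , q ← cycle⇒climb G p = _ , s , (q ◅◅ r ◅ ε)

  -- The length `k` is separated from `n` because the induction shortens the vector but not the
  -- subsets in it.
  numArcs-insert : ∀ {k} (G : Vec (Subset n) k) i m → lookup G i ≡ Subset.⊥ →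
                   Vec.sum (Vec.map ∣_∣ (G [ i ]≔ ⁅ m ⁆)) ≡ suc (Vec.sum (Vec.map ∣_∣ G))
  numArcs-insert (S ∷ G) zero    m ≡.refl = ≡.cong₂ ℕ._+_ (∣⁅x⁆∣≡1 m)
    (≡.cong (ℕ._+ Vec.sum (Vec.map ∣_∣ G)) (≡.sym (∣⊥∣≡0 n)))
  numArcs-insert (S ∷ G) (suc i) m eq = ≡.trans (≡.cong (∣ S ∣ ℕ.+_) (numArcs-insert G i m eq))
    (ℕₚ.+-suc ∣ S ∣ _)

  module Insertion (G : Digraph n) (i m : Fin n) (empty : lookup G i ≡ Subset.⊥) where

    G⁺ : Digraph n
    G⁺ = G [ i ]≔ ⁅ m ⁆

    noArc : ∀ {x} → ¬ Arc G x i
    noArc = ∉⊥ ∘ ≡.subst (_ ∈_) empty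

    isRoot : IsRoot G i
    isRoot = ≡.trans (≡.cong ∣_∣ empty) (∣⊥∣≡0 n)

    lookup-≢ : ∀ {j} → j ≢ i → lookup G⁺ j ≡ lookup G j
    lookup-≢ j≢i = Vecₚ.lookup∘update′ j≢i G ⁅ m ⁆

    newArc : Arc G⁺ m i
    newArc = ≡.subst (m ∈_) (≡.sym (Vecₚ.lookup∘update i G ⁅ m ⁆)) (x∈⁅x⁆ m)

    newArc-unique : ∀ {x} → Arc G⁺ x i → x ≡ m
    newArc-unique r = x∈⁅y⁆⇒x≡y m (≡.subst (_ ∈_) (Vecₚ.lookup∘update i G ⁅ m ⁆) r)

    arc⁺ : ∀ {x y} → Arc G x y → Arc G⁺ x y
    arc⁺ {x} {y} r with y ≟ i
    ... | yes ≡.refl = ⊥-elim (noArc r)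
    ... | no y≢i   = ≡.subst (x ∈_) (≡.sym (lookup-≢ y≢i)) r

    arc⁻ : ∀ {x y} → y ≢ i → Arc G⁺ x y → Arc G x y
    arc⁻ y≢i = ≡.subst (_ ∈_) (lookup-≢ y≢i)

    climb⁺ : ∀ {x y} → Climb G x y → Climb G⁺ x y
    climb⁺ = Star.map arc⁺

    -- The climb is cut at its first visit to `i`; up to there every arc enters a vertex other than
    -- `i` and is therefore old.
    climb-to-i : ∀ {x} → Climb G⁺ x i → Climb G x i
    climb-to-i {x} p with x ≟ i
    climb-to-i p       | yes ≡.refl = ε
    climb-to-i ε       | no x≢i   = ⊥-elim (x≢i ≡.refl)
    climb-to-i (r ◅ p) | no x≢i   = arc⁻ x≢i r ◅ climb-to-i p

    -- A climb using the new arc is cut at its first arrival at `i` and after its last passage to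
    -- `m`; any loops in between are dropped.
    climb⁻ : ∀ {x y} → Climb G⁺ x y → Climb G x y ⊎ (Climb G x i × Climb G m y)
    climb⁻ ε = inj₁ ε
    climb⁻ {x} (r ◅ p) with x ≟ i | climb⁻ p
    ... | yes ≡.refl | q with ≡.refl ← newArc-unique r = inj₂ (ε , Sum.[ (id) , proj₂ ]′ q)
    ... | no x≢i   | inj₁ q       = inj₁ (arc⁻ x≢i r ◅ q)
    ... | no x≢i   | inj₂ (q , s) = inj₂ (arc⁻ x≢i r ◅ q , s)

    acyclic⁺ : Acyclic G → ¬ Climb G m i → Acyclic G⁺
    acyclic⁺ acyc ¬mi x c with x ≟ i
    ... | yes ≡.refl with _ , r , p ← cycle⇒climb G⁺ c
      rewrite newArc-unique r = ¬mi (climb-to-i p)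
    ... | no x≢i with _ , r , p ← cycle⇒climb G⁺ c | climb⁻ p
    ...   | inj₁ q       = acyc x (climb⇒cycle G (arc⁻ x≢i r) q)
    ...   | inj₂ (q , s) = ¬mi (s ◅◅ arc⁻ x≢i r ◅ q)

    acyclic⁻ : Acyclic G⁺ → Acyclic G
    acyclic⁻ acyc x c with _ , r , p ← cycle⇒climb G c = acyc x (climb⇒cycle G⁺ (arc⁺ r) (climb⁺ p))

    indegree-≢ : ∀ {j} → j ≢ i → indegree G⁺ j ≡ indegree G j
    indegree-≢ = ≡.cong ∣_∣ ∘ lookup-≢

    indegree-new : indegree G⁺ i ≡ 1
    indegree-new = ≡.trans (≡.cong ∣_∣ (Vecₚ.lookup∘update i G ⁅ m ⁆)) (∣⁅x⁆∣≡1 m)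

    functional⁺ : Functional G → Functional G⁺
    functional⁺ f j with j ≟ i
    ... | yes ≡.refl = ℕₚ.≤-reflexive indegree-new
    ... | no j≢i   = ≡.subst (ℕ._≤ 1) (≡.sym (indegree-≢ j≢i)) (f j)

    functional⁻ : Functional G⁺ → Functional G
    functional⁻ f j with j ≟ i
    ... | yes ≡.refl = ≡.subst (ℕ._≤ 1) (≡.sym isRoot) ℕ.z≤n
    ... | no j≢i   = ≡.subst (ℕ._≤ 1) (indegree-≢ j≢i) (f j)

    module _ (D : Digraph n) where

      -- A new circuit would have to pass through `m → i` and so contain a climb from `m` to `i`.
      -- With `isOutForest⁻`, which gives the converse, this decides exactly which insertions are
      -- admissible.
      isOutForest⁺ : IsOutForest D G → Arc D m i → ¬ InTreeRootedAt G m i → IsOutForest D G⁺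
      isOutForest⁺ (sub , acyc , f) m→i ¬mi =
        sub⁺ , acyclic⁺ acyc (λ c → ¬mi (isRoot , climb⇒connected G c)) , functional⁺ f
        where
        sub⁺ : Subgraph G⁺ D
        sub⁺ j r with j ≟ i
        ... | yes ≡.refl rewrite newArc-unique r = m→i
        ... | no j≢i   = sub j (arc⁻ j≢i r)

      isOutForest⁻ : IsOutForest D G⁺ → IsOutForest D G × Arc D m i × ¬ InTreeRootedAt G m i
      isOutForest⁻ (sub , acyc , f) =
        ((λ j → sub j ∘ arc⁺) , acyclic⁻ acyc , functional⁻ f) ,
        sub i newArc ,
        λ t → acyc i (climb⇒cycle G⁺ newArc (climb⁺ (inTree⇒climb G (functional⁻ f) t)))

    inTree-new : ∀ {x} → ¬ InTreeRootedAt G⁺ x i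
    inTree-new (root , _) = ∣p∣≡0⇒x∉p root m newArc

    module _ (f : Functional G) {j} (j≢i : j ≢ i) where

      -- Inserting `m → i` hangs the whole tree of `i` below `m`: its vertices inherit the root of
      -- `m`, and all others keep theirs.
      inTree⁺ : ∀ {x} → InTreeRootedAt G x j ⊎ (InTreeRootedAt G x i × InTreeRootedAt G m j) →
                InTreeRootedAt G⁺ x j
      inTree⁺ (inj₁ t@(root , _)) =
        ≡.trans (indegree-≢ j≢i) root , climb⇒connected G⁺ (climb⁺ (inTree⇒climb G f t))
      inTree⁺ (inj₂ (s , t@(root , _))) =
        ≡.trans (indegree-≢ j≢i) root ,
        climb⇒connected G⁺ (climb⁺ (inTree⇒climb G f s) ◅◅ newArc ◅ climb⁺ (inTree⇒climb G f t))

      inTree⁻ : ∀ {x} → InTreeRootedAt G⁺ x j →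
                InTreeRootedAt G x j ⊎ (InTreeRootedAt G x i × InTreeRootedAt G m j)
      inTree⁻ t@(root⁺ , _) = Sum.map inTree (λ (p , q) → (isRoot , climb⇒connected G p) , inTree q)
        (climb⁻ (inTree⇒climb G⁺ (functional⁺ f) t))
        where
        inTree : ∀ {y} → Climb G y j → InTreeRootedAt G y j
        inTree p = ≡.trans (≡.sym (indegree-≢ j≢i)) root⁺ , climb⇒connected G p

-- Sums over digraphs

∣p∣≡0⇒p≡⊥ : ∀ {n} {p : Subset n} → ∣ p ∣ ≡ 0 → p ≡ Subset.⊥
∣p∣≡0⇒p≡⊥ {p = []}        eq = ≡.refl
∣p∣≡0⇒p≡⊥ {p = false ∷ p} eq = ≡.cong (false ∷_) (∣p∣≡0⇒p≡⊥ eq)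

module _ {c ℓ} (M : CommutativeMonoid c ℓ) where
  open CommutativeMonoid M renaming (ε to 0#)
  open CommutativeMonoidSum M

  -- Stated for commutative monoids because it serves both sums of matrix entries and products of
  -- arc weights, where the neutral element is 1.
  sum-δ : ∀ {n} (m : Fin n) x → sum (λ k → if does (k ≟ m) then x else 0#) ≈ x
  sum-δ {suc n} zero    x = trans (∙-congˡ (sum-replicate-zero n)) (identityʳ x)
  sum-δ {suc n} (suc m) x = trans (identityˡ _) (sum-δ m x)

module Sums {c ℓ₁ ℓ₂ ℓ₃} (F : OrderedField c ℓ₁ ℓ₂ ℓ₃) where
  open OrderedField F
  open CommutativeRing commutativeRing public
    using (semiring; commutativeSemiring; +-commutativeMonoid; *-commutativeMonoid; ring)
  open SemiringSum semiring public
    using (∑-distrib-+; ∑-comm; sum-cong-≋; *-distribˡ-sum; *-distribʳ-sum; sum-replicate-zero)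
  open import Relation.Binary.Reasoning.Setoid setoid
  open RingSolver commutativeSemiring using (solve; _:=_; _:+_; _:*_)

  χ : ∀ {p} {P : Set p} → Dec P → Carrier
  χ P? = if does P? then 1# else 0#

  -- Allows an equation valid only under `P` to be used inside a sum: where `P` fails, both terms
  -- are zero.
  χ-* : ∀ {p} {P : Set p} (P? : Dec P) {x y} → (P → x ≈ y) → χ P? * x ≈ χ P? * y
  χ-* (yes p) x≈y = *-congˡ (x≈y p)
  χ-* (no ¬p) x≈y = trans (zeroˡ _) (sym (zeroˡ _))

  χ-yes : ∀ {p} {P : Set p} (P? : Dec P) → P → χ P? ≈ 1#
  χ-yes (yes _) _ = refl
  χ-yes (no ¬p) p = ⊥-elim (¬p p)

  χ-no : ∀ {p} {P : Set p} (P? : Dec P) → ¬ P → χ P? ≈ 0#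
  χ-no (yes p) ¬p = ⊥-elim (¬p p)
  χ-no (no _)  _  = refl

  χ-¬+χ : ∀ {p} {P : Set p} (P? : Dec P) → χ (¬? P?) + χ P? ≈ 1#
  χ-¬+χ (yes _) = +-identityˡ 1#
  χ-¬+χ (no _)  = +-identityʳ 1#

  module _ {p q} {P : Set p} {Q : Set q} where

    χ-¬*χ : (P? : Dec P) (Q? : Dec Q) → (P → ¬ Q) → χ (¬? P?) * χ Q? ≈ χ Q?
    χ-¬*χ (no _)  _       _  = *-identityˡ _
    χ-¬*χ (yes _) (no _)  _  = zeroʳ _
    χ-¬*χ (yes p) (yes q) pq = ⊥-elim (pq p q)

    χ-× : ∀ {r} {R : Set r} (P? : Dec P) (Q? : Dec Q) (R? : Dec R) →
          (P → Q × R) → (Q × R → P) → χ P? ≈ χ Q? * χ R?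
    χ-× (yes _) (yes _) (yes _) to from = sym (*-identityˡ _)
    χ-× (yes p) (yes _) (no ¬r) to from = ⊥-elim (¬r (proj₂ (to p)))
    χ-× (yes p) (no ¬q) _       to from = ⊥-elim (¬q (proj₁ (to p)))
    χ-× (no ¬p) (yes q) (yes r) to from = ⊥-elim (¬p (from (q , r)))
    χ-× (no _)  (yes _) (no _)  to from = sym (zeroʳ _)
    χ-× (no _)  (no _)  _       to from = sym (zeroˡ _)

    χ-⊎× : ∀ {r s} {R : Set r} {S : Set s} (S? : Dec S) (P? : Dec P) (Q? : Dec Q) (R? : Dec R) →
           (S → P ⊎ (Q × R)) → (P ⊎ (Q × R) → S) → (P → ¬ Q) →
           χ S? ≈ χ P? + χ Q? * χ R?
    χ-⊎× _       (yes p) (yes q) _       to from pq = ⊥-elim (pq p q)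
    χ-⊎× (no ¬s) (yes p) _       _       to from pq = ⊥-elim (¬s (from (inj₁ p)))
    χ-⊎× (no ¬s) _       (yes q) (yes r) to from pq = ⊥-elim (¬s (from (inj₂ (q , r))))
    χ-⊎× (no _)  (no _)  (yes _) (no _)  to from pq = sym (trans (+-identityˡ _) (zeroʳ _))
    χ-⊎× (no _)  (no _)  (no _)  _       to from pq = sym (trans (+-identityˡ _) (zeroˡ _))
    χ-⊎× (yes _) (yes _) (no _)  _       to from pq = sym (trans (+-congˡ (zeroˡ _)) (+-identityʳ _))
    χ-⊎× (yes _) (no _)  (yes _) (yes _) to from pq = sym (trans (+-identityˡ _) (*-identityˡ _))
    χ-⊎× (yes s) (no ¬p) (no ¬q) _       to from pq = ⊥-elim (Sum.[ ¬p , ¬q ∘ proj₁ ]′ (to s))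
    χ-⊎× (yes s) (no ¬p) (yes _) (no ¬r) to from pq = ⊥-elim (Sum.[ ¬p , ¬r ∘ proj₂ ]′ (to s))

  module _ {a} {A : Set a} where

    ∑∈ : List A → (A → Carrier) → Carrier
    ∑∈ xs f = ∑ˡ (List.map f xs)

    ∑∈-cong : ∀ xs {f g} → (∀ x → f x ≈ g x) → ∑∈ xs f ≈ ∑∈ xs g
    ∑∈-cong []       f≈g = refl
    ∑∈-cong (x ∷ xs) f≈g = +-cong (f≈g x) (∑∈-cong xs f≈g)

    ∑∈-+ : ∀ xs f g → ∑∈ xs (λ x → f x + g x) ≈ ∑∈ xs f + ∑∈ xs g
    ∑∈-+ []       f g = sym (+-identityʳ 0#)
    ∑∈-+ (x ∷ xs) f g = trans (+-congˡ (∑∈-+ xs f g))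
      (solve 4 (λ a b c d → (a :+ b) :+ (c :+ d) := (a :+ c) :+ (b :+ d)) refl _ _ _ _)

    ∑∈-* : ∀ xs a f → ∑∈ xs (λ x → a * f x) ≈ a * ∑∈ xs f
    ∑∈-* []       a f = sym (zeroʳ a)
    ∑∈-* (x ∷ xs) a f = trans (+-congˡ (∑∈-* xs a f)) (sym (distribˡ a _ _))

    ∑∈-0 : ∀ xs {f} → (∀ x → f x ≈ 0#) → ∑∈ xs f ≈ 0#
    ∑∈-0 []       f≈0 = refl
    ∑∈-0 (x ∷ xs) f≈0 = trans (+-cong (f≈0 x) (∑∈-0 xs f≈0)) (+-identityʳ 0#)

    ∑∈-++ : ∀ xs ys f → ∑∈ (xs ++ ys) f ≈ ∑∈ xs f + ∑∈ ys f
    ∑∈-++ []       ys f = sym (+-identityˡ _)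
    ∑∈-++ (x ∷ xs) ys f = trans (+-congˡ (∑∈-++ xs ys f)) (sym (+-assoc _ _ _))

    ∑∈-filter : ∀ {p} {P : U.Pred A p} (P? : U.Decidable P) xs f →
                ∑∈ (List.filter P? xs) f ≈ ∑∈ xs (λ x → χ (P? x) * f x)
    ∑∈-filter P? []       f = refl
    ∑∈-filter P? (x ∷ xs) f with does (P? x)
    ... | true  = +-cong (sym (*-identityˡ _)) (∑∈-filter P? xs f)
    ... | false = trans (∑∈-filter P? xs f) (trans (sym (+-identityˡ _)) (+-congʳ (sym (zeroˡ _))))

    ∑∈-∑ : ∀ {n} xs (f : Fin n → A → Carrier) →
           ∑∈ xs (λ x → ∑ λ m → f m x) ≈ ∑ (λ m → ∑∈ xs (f m))
    ∑∈-∑ {n} []       f = sym (sum-replicate-zero n)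
    ∑∈-∑     (x ∷ xs) f = trans (+-congˡ (∑∈-∑ xs f)) (sym (∑-distrib-+ (λ m → f m x) _))

  ∑∈-map : ∀ {a b} {A : Set a} {B : Set b} (g : A → B) xs f → ∑∈ (List.map g xs) f ≈ ∑∈ xs (f ∘ g)
  ∑∈-map g []       f = refl
  ∑∈-map g (x ∷ xs) f = +-congˡ (∑∈-map g xs f)

  module _ {a b} {A : Set a} {B : Set b} where

    ∑∈-comm : ∀ xs ys (f : A → B → Carrier) →
              ∑∈ xs (λ x → ∑∈ ys (f x)) ≈ ∑∈ ys (λ y → ∑∈ xs (λ x → f x y))
    ∑∈-comm []       ys f = sym (∑∈-0 ys λ _ → refl)
    ∑∈-comm (x ∷ xs) ys f = trans (+-congˡ (∑∈-comm xs ys f)) (sym (∑∈-+ ys (f x) _))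

    ∑∈-cartesianProductWith : ∀ {c} {C : Set c} (g : A → B → C) xs ys f →
      ∑∈ (List.cartesianProductWith g xs ys) f ≈ ∑∈ xs (λ x → ∑∈ ys (λ y → f (g x y)))
    ∑∈-cartesianProductWith g []       ys f = refl
    ∑∈-cartesianProductWith g (x ∷ xs) ys f = trans (∑∈-++ (List.map (g x) ys) _ f)
      (+-cong (∑∈-map (g x) ys f) (∑∈-cartesianProductWith g xs ys f))

  -- Vectors are grouped by their entries other than the `i`-th, and `p`, of total 1 over `xs`,
  -- distributes each group sum among the members. If `p` is the indicator of one element, this
  -- picks one representative of each group.
  ∑∈-vectors-update : ∀ {a} {A : Set a} xs (p : A → Carrier) → (∀ y → ∑∈ xs (λ x → p x * y) ≈ y) →
    ∀ {n} (i : Fin n) f →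
    ∑∈ (vectors xs n) f ≈ ∑∈ (vectors xs n) (λ v → p (lookup v i) * ∑∈ xs (λ x → f (v [ i ]≔ x)))
  ∑∈-vectors-update xs p δ {suc n} zero f = begin
    ∑∈ (vectors xs (suc n)) f
      ≈⟨ ∑∈-cartesianProductWith _∷_ xs (vectors xs n) f ⟩
    ∑∈ xs (λ x → ∑∈ (vectors xs n) (λ v → f (x ∷ v)))
      ≈⟨ ∑∈-comm xs (vectors xs n) _ ⟩
    ∑∈ (vectors xs n) (λ v → ∑∈ xs (λ x → f (x ∷ v)))
      ≈⟨ ∑∈-cong (vectors xs n) (λ v → sym (δ _)) ⟩
    ∑∈ (vectors xs n) (λ v → ∑∈ xs (λ x → p x * ∑∈ xs (λ y → f (y ∷ v))))
      ≈⟨ ∑∈-comm (vectors xs n) xs _ ⟩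
    ∑∈ xs (λ x → ∑∈ (vectors xs n) (λ v → p x * ∑∈ xs (λ y → f (y ∷ v))))
      ≈⟨ ∑∈-cartesianProductWith _∷_ xs (vectors xs n) _ ⟨
    ∑∈ (vectors xs (suc n)) (λ v → p (lookup v zero) * ∑∈ xs (λ x → f (v [ zero ]≔ x))) ∎
  ∑∈-vectors-update xs p δ {suc n} (suc i) f = begin
    ∑∈ (vectors xs (suc n)) f
      ≈⟨ ∑∈-cartesianProductWith _∷_ xs (vectors xs n) f ⟩
    ∑∈ xs (λ x → ∑∈ (vectors xs n) (λ v → f (x ∷ v)))
      ≈⟨ ∑∈-cong xs (λ x → ∑∈-vectors-update xs p δ i (λ v → f (x ∷ v))) ⟩
    ∑∈ xs (λ x → ∑∈ (vectors xs n) (λ v → p (lookup v i) * ∑∈ xs (λ y → f (x ∷ (v [ i ]≔ y)))))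
      ≈⟨ ∑∈-cartesianProductWith _∷_ xs (vectors xs n) _ ⟨
    ∑∈ (vectors xs (suc n)) (λ v → p (lookup v (suc i)) * ∑∈ xs (λ x → f (v [ suc i ]≔ x))) ∎

  ∑∈-subsets : ∀ {n} f →
    ∑∈ (subsets (suc n)) f ≈
    ∑∈ (subsets n) (λ S → f (true ∷ S)) + ∑∈ (subsets n) (λ S → f (false ∷ S))
  ∑∈-subsets {n} f =
    trans (∑∈-cartesianProductWith _∷_ (true ∷ false ∷ []) (subsets n) f) (+-congˡ (+-identityʳ _))

  ∑∈-subsets-∅ : ∀ {n} f → (∀ S → ∣ S ∣ ≢ 0 → f S ≈ 0#) → ∑∈ (subsets n) f ≈ f Subset.⊥
  ∑∈-subsets-∅ {zero}  f f≈0 = +-identityʳ _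
  ∑∈-subsets-∅ {suc n} f f≈0 = begin
    ∑∈ (subsets (suc n)) f
      ≈⟨ ∑∈-subsets f ⟩
    ∑∈ (subsets n) (λ S → f (true ∷ S)) + ∑∈ (subsets n) (λ S → f (false ∷ S))
      ≈⟨ +-cong (∑∈-0 (subsets n) (λ S → f≈0 (true ∷ S) λ ()))
                (∑∈-subsets-∅ (λ S → f (false ∷ S)) (λ S → f≈0 (false ∷ S))) ⟩
    0# + f Subset.⊥
      ≈⟨ +-identityˡ _ ⟩
    f Subset.⊥ ∎

  ∑∈-subsets-≤1 : ∀ {n} f → (∀ S → ¬ ∣ S ∣ ℕ.≤ 1 → f S ≈ 0#) →
                  ∑∈ (subsets n) f ≈ f Subset.⊥ + ∑ (λ m → f ⁅ m ⁆)
  ∑∈-subsets-≤1 {zero}  f f≈0 = refl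
  ∑∈-subsets-≤1 {suc n} f f≈0 = begin
    ∑∈ (subsets (suc n)) f
      ≈⟨ ∑∈-subsets f ⟩
    ∑∈ (subsets n) (λ S → f (true ∷ S)) + ∑∈ (subsets n) (λ S → f (false ∷ S))
      ≈⟨ +-cong (∑∈-subsets-∅ (λ S → f (true ∷ S))
                  (λ S S≢0 → f≈0 (true ∷ S) (λ { (ℕ.s≤s S≤0) → S≢0 (ℕₚ.n≤0⇒n≡0 S≤0) })))
                (∑∈-subsets-≤1 (λ S → f (false ∷ S)) (λ S → f≈0 (false ∷ S))) ⟩
    f ⁅ zero ⁆ + (f Subset.⊥ + ∑ (λ m → f ⁅ suc m ⁆))
      ≈⟨ solve 3 (λ a b c → a :+ (b :+ c) := b :+ (a :+ c)) refl _ _ _ ⟩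
    f Subset.⊥ + (f ⁅ zero ⁆ + ∑ (λ m → f ⁅ suc m ⁆)) ∎

  -- The representative of a digraph is what is left after deleting the arcs into `i`:
  -- `∑∈-vectors-update` is applied with the indicator of the empty set of tails, and only sets with
  -- at most one tail contribute.
  ∑∈-digraphs : ∀ {n} (i : Fin n) f → (∀ G → ¬ indegree G i ℕ.≤ 1 → f G ≈ 0#) →
    ∑∈ (digraphs n) f ≈
    ∑∈ (digraphs n) (λ G → χ (indegree G i ℕₚ.≟ 0) * (f G + ∑ λ m → f (G [ i ]≔ ⁅ m ⁆)))
  ∑∈-digraphs {n} i f f≈0 = trans
    (∑∈-vectors-update (subsets n) (λ S → χ (∣ S ∣ ℕₚ.≟ 0)) δ i f)
    (∑∈-cong (digraphs n) λ G → χ-* (indegree G i ℕₚ.≟ 0) λ root →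
      trans (∑∈-subsets-≤1 (λ S → f (G [ i ]≔ S)) (λ S ¬S≤1 → f≈0 (G [ i ]≔ S)
              (¬S≤1 ∘ ≡.subst (λ T → ∣ T ∣ ℕ.≤ 1) (Vecₚ.lookup∘update i G S))))
            (+-congʳ (reflexive (≡.cong f (restore G root)))))
    where
    δ : ∀ y → ∑∈ (subsets n) (λ S → χ (∣ S ∣ ℕₚ.≟ 0) * y) ≈ y
    δ y = begin
      ∑∈ (subsets n) (λ S → χ (∣ S ∣ ℕₚ.≟ 0) * y)
        ≈⟨ ∑∈-subsets-∅ {n} _ (λ S S≢0 → trans (*-congʳ (χ-no (∣ S ∣ ℕₚ.≟ 0) S≢0)) (zeroˡ y)) ⟩
      χ (∣ Subset.⊥ {n} ∣ ℕₚ.≟ 0) * y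
        ≈⟨ *-congʳ (χ-yes (_ ℕₚ.≟ 0) (∣⊥∣≡0 n)) ⟩
      1# * y
        ≈⟨ *-identityˡ y ⟩
      y ∎
    restore : ∀ G → indegree G i ≡ 0 → G [ i ]≔ Subset.⊥ ≡ G
    restore G root = ≡.trans (≡.cong (G [ i ]≔_) (≡.sym (∣p∣≡0⇒p≡⊥ root))) (Vecₚ.[]≔-lookup G i)

-- The recurrence for out forests

module Forests {c ℓ₁ ℓ₂ ℓ₃} (F : OrderedField c ℓ₁ ℓ₂ ℓ₃) {n} (Γ : WeightedDigraph F n) where
  open OrderedField F
  open Sums F
  open Matrices F
  open WeightedDigraph Γ
  open import Relation.Binary.Reasoning.Setoid setoid
  open RingSolver commutativeSemiring using (solve; _:=_; _:+_; _:*_)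

  subgraphWeight-insert : ∀ G i m → lookup G i ≡ Subset.⊥ →
    subgraphWeight Γ (G [ i ]≔ ⁅ m ⁆) ≈ weight m i * subgraphWeight Γ G
  subgraphWeight-insert G i m empty = begin
    (∏ λ a → ∏ λ b → factor G⁺ a b)
      ≈⟨ Π.sum-cong-≋ {n} (λ a → Π.sum-cong-≋ {n} (factor⁺ a)) ⟩
    (∏ λ a → ∏ λ b → δ a b * factor G a b)
      ≈⟨ Π.sum-cong-≋ {n} (λ a → Π.∑-distrib-+ {n} (δ a) (factor G a)) ⟩
    (∏ λ a → ∏ (δ a) * ∏ (factor G a))
      ≈⟨ Π.∑-distrib-+ {n} (λ a → ∏ (δ a)) (λ a → ∏ (factor G a)) ⟩
    (∏ λ a → ∏ (δ a)) * subgraphWeight Γ G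
      ≈⟨ *-congʳ (Π.sum-cong-≋ {n} ∏δ) ⟩
    (∏ λ a → if does (a ≟ m) then weight m i else 1#) * subgraphWeight Γ G
      ≈⟨ *-congʳ (sum-δ *-commutativeMonoid m (weight m i)) ⟩
    weight m i * subgraphWeight Γ G ∎
    where
    open Insertion G i m empty
    module Π = CommutativeMonoidSum *-commutativeMonoid
    factor : Digraph n → Fin n → Fin n → Carrier
    factor G a b = if does (arc? G a b) then weight a b else 1#
    -- The factor by which the insertion changes the product at `(a , b)`: `weight m i` at `(m , i)`
    -- and 1 elsewhere. The nesting lets `sum-δ` collapse first the inner and then the outer
    -- product.
    δ : Fin n → Fin n → Carrier
    δ a b = if does (b ≟ i) then (if does (a ≟ m) then weight m i else 1#) else 1#
    ∏δ : ∀ a → ∏ (δ a) ≈ (if does (a ≟ m) then weight m i else 1#)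
    ∏δ a = sum-δ *-commutativeMonoid i _
    factor⁺ : ∀ a b → factor G⁺ a b ≈ δ a b * factor G a b
    factor⁺ a b with b ≟ i
    ... | yes ≡.refl rewrite dec-false (arc? G a i) noArc with a ≟ m
    ...   | yes ≡.refl rewrite dec-true (arc? G⁺ m i) newArc = sym (*-identityʳ _)
    ...   | no a≢m rewrite dec-false (arc? G⁺ a i) (a≢m ∘ newArc-unique) = sym (*-identityʳ _)
    factor⁺ a b | no b≢i rewrite lookup-≢ b≢i = sym (*-identityˡ _)

  τ : Digraph n → Fin n → Fin n → Carrier
  τ G x j = χ (inTreeRootedAt? x j G)

  -- With κ the indicator function of k, only the out forests with k arcs
  -- remain; κ ∘ suc then belongs to k - 1, and vanishes if k = 0.
  φ : (ℕ → Carrier) → Digraph n → Carrier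
  φ κ G = χ (isOutForest? digraph G) * (κ (numArcs G) * subgraphWeight Γ G)

  σ : (ℕ → Carrier) → Carrier
  σ κ = ∑∈ (digraphs n) (φ κ)

  Q : (ℕ → Carrier) → Matrix n
  Q κ x j = ∑∈ (digraphs n) (λ G → φ κ G * τ G x j)

  -- Every out forest arises from one in which i is a root by inserting no arc
  -- or one arc m → i, where m does not belong to the tree of i.
  module Splitting (i : Fin n) where

    ψ : (ℕ → Carrier) → Digraph n → Carrier
    ψ κ G = χ (indegree G i ℕₚ.≟ 0) * φ κ G

    τ̄ : Digraph n → Fin n → Carrier
    τ̄ G m = χ (¬? (inTreeRootedAt? m i G))

    ψ-cong : ∀ κ G {x y} → (lookup G i ≡ Subset.⊥ → IsOutForest digraph G → x ≈ y) →
             ψ κ G * x ≈ ψ κ G * y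
    ψ-cong κ G {x} {y} x≈y = trans (assoc x) (trans
      (χ-* (indegree G i ℕₚ.≟ 0) λ root → χ-* (isOutForest? digraph G) λ forest →
        *-congˡ (x≈y (∣p∣≡0⇒p≡⊥ root) forest))
      (sym (assoc y)))
      where
      assoc : ∀ z → ψ κ G * z ≈ χ (indegree G i ℕₚ.≟ 0) *
        (χ (isOutForest? digraph G) * (κ (numArcs G) * subgraphWeight Γ G * z))
      assoc = solve 4 (λ a b c z → a :* (b :* c) :* z := a :* (b :* (c :* z))) refl _ _ _

    -- Besides a circuit, the only obstacle to insertion is that Γ has no arc `m → i`, and then the
    -- weight is zero. Sums can therefore run over all vertices `m`.
    χ-insert : ∀ G m → lookup G i ≡ Subset.⊥ →
      (f⁺? : Dec (IsOutForest digraph (G [ i ]≔ ⁅ m ⁆))) (f? : Dec (IsOutForest digraph G))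
      (t? : Dec (InTreeRootedAt G m i)) →
      χ f⁺? * weight m i ≈ χ f? * (weight m i * χ (¬? t?))
    χ-insert G m empty = λ where
        (yes f⁺) (no ¬f) _        → ⊥-elim (¬f (proj₁ (isOutForest⁻ digraph f⁺)))
        (yes f⁺) (yes _) (yes t)  → ⊥-elim (proj₂ (proj₂ (isOutForest⁻ digraph f⁺)) t)
        (yes _)  (yes _) (no _)   → *-congˡ (sym (*-identityʳ _))
        (no _)   (no _)  _        → trans (zeroˡ _) (sym (zeroˡ _))
        (no _)   (yes _) (yes _)  → trans (zeroˡ _) (sym (trans (*-congˡ (zeroʳ _)) (zeroʳ _)))
        (no ¬f⁺) (yes f) (no ¬t)  →
          let ε≈0 = weight-0 (λ m→i → ¬f⁺ (isOutForest⁺ digraph f m→i ¬t)) in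
          trans (zeroˡ _) (sym (trans (*-congˡ (trans (*-congʳ ε≈0) (zeroˡ _))) (zeroʳ _)))
      where open Insertion G i m empty

    φ-insert : ∀ κ G m → lookup G i ≡ Subset.⊥ →
               φ κ (G [ i ]≔ ⁅ m ⁆) ≈ φ (κ ∘ suc) G * (weight m i * τ̄ G m)
    φ-insert κ G m empty = begin
      χ f⁺? * (κ (numArcs (G [ i ]≔ ⁅ m ⁆)) * subgraphWeight Γ (G [ i ]≔ ⁅ m ⁆))
        ≈⟨ *-congˡ (*-cong (reflexive (≡.cong κ (numArcs-insert G i m empty)))
                           (subgraphWeight-insert G i m empty)) ⟩
      χ f⁺? * (κ (suc (numArcs G)) * (weight m i * subgraphWeight Γ G))
        ≈⟨ solve 4 (λ a b c d → a :* (b :* (c :* d)) := a :* c :* (b :* d)) refl _ _ _ _ ⟩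
      χ f⁺? * weight m i * (κ (suc (numArcs G)) * subgraphWeight Γ G)
        ≈⟨ *-congʳ (χ-insert G m empty f⁺? f? (inTreeRootedAt? m i G)) ⟩
      χ f? * (weight m i * τ̄ G m) * (κ (suc (numArcs G)) * subgraphWeight Γ G)
        ≈⟨ solve 3 (λ a b c → a :* b :* c := a :* c :* b) refl _ _ _ ⟩
      φ (κ ∘ suc) G * (weight m i * τ̄ G m) ∎
      where
      f⁺? = isOutForest? digraph (G [ i ]≔ ⁅ m ⁆)
      f?  = isOutForest? digraph G

    φ-support : ∀ κ G x → ¬ indegree G i ℕ.≤ 1 → φ κ G * x ≈ 0#
    φ-support κ G x ¬G≤1 = trans (*-congʳ (trans
      (*-congʳ (χ-no (isOutForest? digraph G) λ (_ , _ , f) → ¬G≤1 (f i))) (zeroˡ _))) (zeroˡ x)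

    -- `t⁺ m G` is the value of `t` after insertion, expressed through `G`; it only has to be
    -- correct on out forests with root `i`, as `ψ` kills the other terms.
    φ-split : ∀ κ (t : Digraph n → Carrier) (t⁺ : Fin n → Digraph n → Carrier) →
      (∀ G m → lookup G i ≡ Subset.⊥ → IsOutForest digraph G → t (G [ i ]≔ ⁅ m ⁆) ≈ t⁺ m G) →
      ∑∈ (digraphs n) (λ G → φ κ G * t G) ≈
      ∑∈ (digraphs n) (λ G → ψ κ G * t G +
        ψ (κ ∘ suc) G * (∑ λ m → weight m i * τ̄ G m * t⁺ m G))
    φ-split κ t t⁺ t≈t⁺ = trans
      (∑∈-digraphs i _ (λ G → φ-support κ G (t G)))
      (∑∈-cong (digraphs n) λ G → begin
        χ (indegree G i ℕₚ.≟ 0) *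
          (φ κ G * t G + ∑ λ m → φ κ (G [ i ]≔ ⁅ m ⁆) * t (G [ i ]≔ ⁅ m ⁆))
          ≈⟨ χ-* (indegree G i ℕₚ.≟ 0) (λ root → +-congˡ (sum-cong-≋ {n} λ m →
               *-congʳ (φ-insert κ G m (∣p∣≡0⇒p≡⊥ root)))) ⟩
        χ (indegree G i ℕₚ.≟ 0) *
          (φ κ G * t G + ∑ λ m → φ (κ ∘ suc) G * (weight m i * τ̄ G m) * t (G [ i ]≔ ⁅ m ⁆))
          ≈⟨ *-congˡ (+-congˡ (trans (sum-cong-≋ {n} λ m → *-assoc _ _ _)
               (sym (*-distribˡ-sum {n} (φ (κ ∘ suc) G) _)))) ⟩
        χ (indegree G i ℕₚ.≟ 0) * (φ κ G * t G +
          φ (κ ∘ suc) G * (∑ λ m → weight m i * τ̄ G m * t (G [ i ]≔ ⁅ m ⁆)))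
          ≈⟨ solve 5 (λ r a b c d → r :* (a :* b :+ c :* d) := r :* a :* b :+ r :* c :* d)
               refl _ _ _ _ _ ⟩
        ψ κ G * t G + ψ (κ ∘ suc) G * (∑ λ m → weight m i * τ̄ G m * t (G [ i ]≔ ⁅ m ⁆))
          ≈⟨ +-congˡ (ψ-cong (κ ∘ suc) G λ empty forest →
               sum-cong-≋ {n} λ m → *-congˡ (t≈t⁺ G m empty forest)) ⟩
        ψ κ G * t G + ψ (κ ∘ suc) G * (∑ λ m → weight m i * τ̄ G m * t⁺ m G) ∎)

    -- The weight of the arcs of Γ that lead to `i` from the tree rooted at `j`. If `i` is a root,
    -- `Ā` weighs the arcs into `i` that may be inserted, and `A G i` those that would close a
    -- circuit; `d` is the diagonal entry of the Kirchhoff matrix.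
    A : Digraph n → Fin n → Carrier
    A G j = ∑ λ m → weight m i * τ G m j

    Ā : Digraph n → Carrier
    Ā G = ∑ λ m → weight m i * τ̄ G m

    d : Carrier
    d = ∑ λ m → weight m i

    Ā+A≈d : ∀ G → Ā G + A G i ≈ d
    Ā+A≈d G = trans (sym (∑-distrib-+ {n} _ _)) (sum-cong-≋ {n} λ m →
      trans (sym (distribˡ _ _ _)) (trans (*-congˡ (τ̄+τ m)) (*-identityʳ _)))
      where
      τ̄+τ : ∀ m → τ̄ G m + τ G m i ≈ 1#
      τ̄+τ m = χ-¬+χ (inTreeRootedAt? m i G)

    τᵢᵢ≈1 : ∀ G → lookup G i ≡ Subset.⊥ → τ G i i ≈ 1#
    τᵢᵢ≈1 G empty =
      χ-yes (inTreeRootedAt? i i G) (≡.trans (≡.cong ∣_∣ empty) (∣⊥∣≡0 n) , Star.ε)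

    module _ {j} (j≢i : j ≢ i) (G : Digraph n) (f : Functional G) where

      τᵢⱼ≈0 : lookup G i ≡ Subset.⊥ → τ G i j ≈ 0#
      τᵢⱼ≈0 empty = χ-no (inTreeRootedAt? i j G) λ t →
        j≢i (inTree-unique G f t (≡.trans (≡.cong ∣_∣ empty) (∣⊥∣≡0 n) , Star.ε))

      τ̄*τ≈τ : ∀ m → τ̄ G m * τ G m j ≈ τ G m j
      τ̄*τ≈τ m = χ-¬*χ (inTreeRootedAt? m i G) (inTreeRootedAt? m j G)
        (λ s t → j≢i (inTree-unique G f t s))

      -- A vertex has only one root, so the two alternatives of `inTree⁻` exclude each other and
      -- their indicators add.
      τ-insert : ∀ m x → lookup G i ≡ Subset.⊥ →
                 τ (G [ i ]≔ ⁅ m ⁆) x j ≈ τ G x j + τ G x i * τ G m j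
      τ-insert m x empty = χ-⊎×
        (inTreeRootedAt? x j (G [ i ]≔ ⁅ m ⁆)) (inTreeRootedAt? x j G)
        (inTreeRootedAt? x i G) (inTreeRootedAt? m j G)
        (inTree⁻ f j≢i) (inTree⁺ f j≢i) (λ t s → j≢i (inTree-unique G f t s))
        where open Insertion G i m empty

    ∑-τ : ∀ G x j → (∑ λ m → weight m i * (x * τ G m j)) ≈ x * A G j
    ∑-τ G x j = trans
      (sum-cong-≋ {n} λ m → solve 3 (λ a b c → a :* (b :* c) := b :* (a :* c)) refl _ _ _)
      (sym (*-distribˡ-sum {n} x _))

    σ-split : ∀ κ → σ κ ≈ ∑∈ (digraphs n) (λ G → ψ κ G + ψ (κ ∘ suc) G * Ā G)
    σ-split κ = begin
      σ κ
        ≈⟨ ∑∈-cong (digraphs n) (λ G → sym (*-identityʳ _)) ⟩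
      ∑∈ (digraphs n) (λ G → φ κ G * 1#)
        ≈⟨ φ-split κ (λ _ → 1#) (λ _ _ → 1#) (λ _ _ _ _ → refl) ⟩
      ∑∈ (digraphs n) (λ G → ψ κ G * 1# + ψ (κ ∘ suc) G * (∑ λ m → weight m i * τ̄ G m * 1#))
        ≈⟨ ∑∈-cong (digraphs n) (λ G →
             +-cong (*-identityʳ _) (*-congˡ (sum-cong-≋ {n} λ m → *-identityʳ _))) ⟩
      ∑∈ (digraphs n) (λ G → ψ κ G + ψ (κ ∘ suc) G * Ā G) ∎

    Q-split-≡ : ∀ κ x → Q κ x i ≈ ∑∈ (digraphs n) (λ G → ψ κ G * τ G x i)
    Q-split-≡ κ x = trans
      (φ-split κ (λ G → τ G x i) (λ _ _ → 0#) (λ G m empty _ →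
        χ-no (inTreeRootedAt? x i (G [ i ]≔ ⁅ m ⁆)) (Insertion.inTree-new G i m empty)))
      (∑∈-cong (digraphs n) λ G → trans
        (+-congˡ (trans
          (*-congˡ (trans (sum-cong-≋ {n} λ m → zeroʳ (weight m i * τ̄ G m)) (sum-replicate-zero n)))
          (zeroʳ _)))
        (+-identityʳ _))

    module _ {j} (j≢i : j ≢ i) where

      -- The last two terms come from insertion: either `x` is already in the tree of `j` and any
      -- admissible arc will do, or `x` is in the tree of `i` and the new arc must start in the tree
      -- of `j`.
      Q-split-≢ : ∀ κ x → Q κ x j ≈ ∑∈ (digraphs n) (λ G →
        ψ κ G * τ G x j + ψ (κ ∘ suc) G * (Ā G * τ G x j + τ G x i * A G j))
      Q-split-≢ κ x = trans
        (φ-split κ (λ G → τ G x j) (λ m G → τ G x j + τ G x i * τ G m j)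
          (λ G m empty (_ , _ , f) → τ-insert j≢i G f m x empty))
        (∑∈-cong (digraphs n) λ G → +-congˡ (ψ-cong (κ ∘ suc) G λ _ (_ , _ , f) → begin
          (∑ λ m → weight m i * τ̄ G m * (τ G x j + τ G x i * τ G m j))
            ≈⟨ sum-cong-≋ {n} (λ m → trans
                 (solve 5 (λ a b c d e → a :* b :* (c :+ d :* e) := a :* b :* c :+ a :* (d :* (b :* e)))
                   refl _ _ _ _ _)
                 (+-congˡ (*-congˡ (*-congˡ (τ̄*τ≈τ j≢i G f m))))) ⟩
          (∑ λ m → weight m i * τ̄ G m * τ G x j + weight m i * (τ G x i * τ G m j))
            ≈⟨ ∑-distrib-+ {n} _ _ ⟩
          (∑ λ m → weight m i * τ̄ G m * τ G x j) + (∑ λ m → weight m i * (τ G x i * τ G m j))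
            ≈⟨ +-cong (sym (*-distribʳ-sum {n} (τ G x j) _)) (∑-τ G (τ G x i) j) ⟩
          Ā G * τ G x j + τ G x i * A G j ∎))

    -- An entry of the matrix recurrence, with the off-diagonal entries of the Kirchhoff matrix
    -- moved to the right so that no subtraction occurs.
    recurrence : ∀ κ j →
      Q κ i j + d * Q (κ ∘ suc) i j ≈ σ κ * 𝟙 i j + ∑ λ m → weight m i * Q (κ ∘ suc) m j
    recurrence κ j with i ≟ j
    ... | yes ≡.refl = begin
      Q κ i i + d * Q (κ ∘ suc) i i
        ≈⟨ +-cong (Qᵢᵢ κ) (trans (*-congˡ (Qᵢᵢ (κ ∘ suc))) (sym (∑∈-* (digraphs n) d _))) ⟩
      ∑∈ (digraphs n) (ψ κ) + ∑∈ (digraphs n) (λ G → d * ψ (κ ∘ suc) G)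
        ≈⟨ ∑∈-+ (digraphs n) _ _ ⟨
      ∑∈ (digraphs n) (λ G → ψ κ G + d * ψ (κ ∘ suc) G)
        -- The part `Ā` of `d` accounts for the forests of `σ` in which an arc enters `i`; the part
        -- `A G i` is left for the sum over `m`.
        ≈⟨ ∑∈-cong (digraphs n) (λ G → trans (+-congˡ (*-congʳ (sym (Ā+A≈d G))))
             (solve 4 (λ p q a b → p :+ (a :+ b) :* q := p :+ q :* a :+ q :* b) refl _ _ _ _)) ⟩
      ∑∈ (digraphs n) (λ G → ψ κ G + ψ (κ ∘ suc) G * Ā G + ψ (κ ∘ suc) G * A G i)
        ≈⟨ ∑∈-+ (digraphs n) _ _ ⟩
      ∑∈ (digraphs n) (λ G → ψ κ G + ψ (κ ∘ suc) G * Ā G) +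
      ∑∈ (digraphs n) (λ G → ψ (κ ∘ suc) G * A G i)
        ≈⟨ +-cong (trans (sym (σ-split κ)) (sym (*-identityʳ _)))
                  (∑∈-cong (digraphs n) λ G → sym (∑-τ G _ i)) ⟩
      σ κ * 1# + ∑∈ (digraphs n) (λ G → ∑ λ m → weight m i * (ψ (κ ∘ suc) G * τ G m i))
        ≈⟨ +-congˡ (trans (∑∈-∑ {n = n} (digraphs n) _) (sum-cong-≋ {n} λ m →
             trans (∑∈-* (digraphs n) _ _) (*-congˡ (sym (Q-split-≡ (κ ∘ suc) m))))) ⟩
      σ κ * 1# + (∑ λ m → weight m i * Q (κ ∘ suc) m i) ∎
      where
      Qᵢᵢ : ∀ κ → Q κ i i ≈ ∑∈ (digraphs n) (ψ κ)
      Qᵢᵢ κ = trans (Q-split-≡ κ i) (∑∈-cong (digraphs n) λ G →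
        trans (ψ-cong κ G (λ empty _ → τᵢᵢ≈1 G empty)) (*-identityʳ _))
    ... | no i≢j = begin
      Q κ i j + d * Q (κ ∘ suc) i j
        ≈⟨ +-cong (Qᵢⱼ κ) (trans (*-congˡ (Qᵢⱼ (κ ∘ suc))) (sym (∑∈-* (digraphs n) d _))) ⟩
      ∑∈ (digraphs n) (λ G → ψ (κ ∘ suc) G * A G j) +
      ∑∈ (digraphs n) (λ G → d * (ψ (κ ∘ (2 ℕ.+_)) G * A G j))
        ≈⟨ ∑∈-+ (digraphs n) _ _ ⟨
      ∑∈ (digraphs n) (λ G → ψ (κ ∘ suc) G * A G j + d * (ψ (κ ∘ (2 ℕ.+_)) G * A G j))
        -- Entries of `Q (κ ∘ suc)` are split at `i` as well; deleting the arc there shifts the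
        -- index a second time, hence `κ ∘ (2 ℕ.+_)`.
        ≈⟨ ∑∈-cong (digraphs n) (λ G → sym (term G)) ⟩
      ∑∈ (digraphs n) (λ G → ∑ λ m → weight m i *
        (ψ (κ ∘ suc) G * τ G m j + ψ (κ ∘ (2 ℕ.+_)) G * (Ā G * τ G m j + τ G m i * A G j)))
        ≈⟨ trans (∑∈-∑ {n = n} (digraphs n) _) (sum-cong-≋ {n} λ m →
             trans (∑∈-* (digraphs n) _ _) (*-congˡ (sym (Q-split-≢ j≢i (κ ∘ suc) m)))) ⟩
      (∑ λ m → weight m i * Q (κ ∘ suc) m j)
        ≈⟨ trans (+-congʳ (zeroʳ _)) (+-identityˡ _) ⟨
      σ κ * 0# + (∑ λ m → weight m i * Q (κ ∘ suc) m j) ∎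
      where
      j≢i : j ≢ i
      j≢i = i≢j ∘ ≡.sym
      -- Without an entering arc, `i` is its own root and not in the tree of `j`; after an insertion
      -- it has the root of `m`, so `m` must lie in the tree of `j`.
      Qᵢⱼ : ∀ κ → Q κ i j ≈ ∑∈ (digraphs n) (λ G → ψ (κ ∘ suc) G * A G j)
      Qᵢⱼ κ = trans (Q-split-≢ j≢i κ i) (∑∈-cong (digraphs n) λ G → trans
        (+-cong
          (trans (ψ-cong κ G (λ empty (_ , _ , f) → τᵢⱼ≈0 j≢i G f empty)) (zeroʳ _))
          (ψ-cong (κ ∘ suc) G (λ empty (_ , _ , f) → trans
            (+-cong (trans (*-congˡ (τᵢⱼ≈0 j≢i G f empty)) (zeroʳ _))
                    (trans (*-congʳ (τᵢᵢ≈1 G empty)) (*-identityˡ _)))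
            (+-identityˡ _))))
        (+-identityˡ _))
      term : ∀ G →
        (∑ λ m → weight m i *
          (ψ (κ ∘ suc) G * τ G m j + ψ (κ ∘ (2 ℕ.+_)) G * (Ā G * τ G m j + τ G m i * A G j))) ≈
        ψ (κ ∘ suc) G * A G j + d * (ψ (κ ∘ (2 ℕ.+_)) G * A G j)
      term G = begin
        (∑ λ m → weight m i * (p * τ G m j + q * (Ā G * τ G m j + τ G m i * A G j)))
          ≈⟨ sum-cong-≋ {n} (λ m →
               solve 7 (λ w p q a b t s → w :* (p :* t :+ q :* (a :* t :+ s :* b)) :=
                                          w :* ((p :+ q :* a) :* t) :+ w :* (q :* b :* s))
                 refl _ _ _ _ _ _ _) ⟩
        (∑ λ m → weight m i * ((p + q * Ā G) * τ G m j) + weight m i * (q * A G j * τ G m i))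
          ≈⟨ trans (∑-distrib-+ {n} _ _) (+-cong (∑-τ G _ j) (∑-τ G _ i)) ⟩
        (p + q * Ā G) * A G j + q * A G j * A G i
          ≈⟨ solve 5 (λ p q a b c → (p :+ q :* a) :* b :+ q :* b :* c := p :* b :+ (a :+ c) :* (q :* b))
               refl _ _ _ _ _ ⟩
        p * A G j + (Ā G + A G i) * (q * A G j)
          ≈⟨ +-congˡ (*-congʳ (Ā+A≈d G)) ⟩
        p * A G j + d * (q * A G j) ∎
        where
        p = ψ (κ ∘ suc) G
        q = ψ (κ ∘ (2 ℕ.+_)) G

-- Group inverses in rings

module _ {c ℓ} (R : Ring c ℓ) where
  open Ring R
  open RingProperties R using (+-cancelʳ; +-cancelˡ)
  open import Relation.Binary.Reasoning.Setoid setoid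

  -- Solved for `q`, the relation reads `s - l * q′`, and everything in this expression commutes
  -- with `l`.
  commutes-step : ∀ {l q q′ s} → q + l * q′ ≈ s → l * s ≈ s * l → l * q′ ≈ q′ * l → l * q ≈ q * l
  commutes-step {l} {q} {q′} {s} q+lq′≈s ls≈sl lq′≈q′l = +-cancelʳ (l * (l * q′)) _ _ (begin
    l * q + l * (l * q′)  ≈⟨ distribˡ l q (l * q′) ⟨
    l * (q + l * q′)      ≈⟨ *-congˡ q+lq′≈s ⟩
    l * s                 ≈⟨ ls≈sl ⟩
    s * l                 ≈⟨ *-congʳ q+lq′≈s ⟨
    (q + l * q′) * l      ≈⟨ distribʳ l q (l * q′) ⟩
    q * l + l * q′ * l    ≈⟨ +-congˡ (trans (*-assoc l q′ l) (*-congˡ (sym lq′≈q′l))) ⟩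
    q * l + l * (l * q′)  ∎)

  module GroupInverse {l y j} (ly+j≈1 : l * y + j ≈ 1#) (lj≈0 : l * j ≈ 0#) (ly≈yl : l * y ≈ y * l) where

    -- `e` and `j` turn out to be complementary idempotents: `l` is invertible on the part of `e`
    -- and zero on that of `j`. Since `y * j` need not vanish, `y` may fail to be the group inverse;
    -- the factor `e` in `y * e` removes that part.
    e : Carrier
    e = l * y

    le≈l : l * e ≈ l
    le≈l = begin
      l * e          ≈⟨ +-identityʳ _ ⟨
      l * e + 0#     ≈⟨ +-congˡ lj≈0 ⟨
      l * e + l * j  ≈⟨ distribˡ l e j ⟨
      l * (e + j)    ≈⟨ *-congˡ ly+j≈1 ⟩
      l * 1#         ≈⟨ *-identityʳ l ⟩
      l              ∎

    el≈l : e * l ≈ l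
    el≈l = trans (*-assoc l y l) (trans (*-congˡ (sym ly≈yl)) le≈l)

    jl≈0 : j * l ≈ 0#
    jl≈0 = +-cancelˡ l _ _ (begin
      l + j * l      ≈⟨ +-congʳ el≈l ⟨
      e * l + j * l  ≈⟨ distribʳ l e j ⟨
      (e + j) * l    ≈⟨ *-congʳ ly+j≈1 ⟩
      1# * l         ≈⟨ *-identityˡ l ⟩
      l              ≈⟨ +-identityʳ l ⟨
      l + 0#         ∎)

    ee≈e : e * e ≈ e
    ee≈e = trans (sym (*-assoc e l y)) (*-congʳ el≈l)

    ye≈ey : y * e ≈ e * y
    ye≈ey = trans (sym (*-assoc y l y)) (*-congʳ (sym ly≈yl))

    ej≈0 : e * j ≈ 0#
    ej≈0 = trans (*-congʳ ly≈yl) (trans (*-assoc y l j) (trans (*-congˡ lj≈0) (zeroʳ y)))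

    jj≈j : j * j ≈ j
    jj≈j = begin
      j * j          ≈⟨ +-identityˡ _ ⟨
      0# + j * j     ≈⟨ +-congʳ ej≈0 ⟨
      e * j + j * j  ≈⟨ distribʳ j e j ⟨
      (e + j) * j    ≈⟨ *-congʳ ly+j≈1 ⟩
      1# * j         ≈⟨ *-identityˡ j ⟩
      j              ∎

    e≈1-j : e ≈ 1# - j
    e≈1-j = begin
      e            ≈⟨ +-identityʳ e ⟨
      e + 0#       ≈⟨ +-congˡ (-‿inverseʳ j) ⟨
      e + (j - j)  ≈⟨ +-assoc e j (- j) ⟨
      e + j - j    ≈⟨ +-congʳ ly+j≈1 ⟩
      1# - j       ∎

    module ShiftedInverse {p} (lp≈0 : l * p ≈ 0#) (pl≈0 : p * l ≈ 0#)
             {q} (lq≈0 : l * q ≈ 0#) (ql≈0 : q * l ≈ 0#)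
             (pq≈j : p * q ≈ j) (qp≈j : q * p ≈ j) where

      -- `p` and `q` stand for α and α⁻¹ times `j`, as an abstract ring has no scalars. On the part
      -- of `e`, `l + p` acts as `l`, with inverse `y * e`; on the part of `j` it acts as `p`, with
      -- inverse `q`.
      z : Carrier
      z = y * e + q

      inverseʳ : (l + p) * z ≈ 1#
      inverseʳ = begin
        (l + p) * z                              ≈⟨ distribʳ z l p ⟩
        l * z + p * z                            ≈⟨ +-cong (distribˡ l (y * e) q) (distribˡ p (y * e) q) ⟩
        l * (y * e) + l * q + (p * (y * e) + p * q)
          ≈⟨ +-cong (trans (+-cong (trans (sym (*-assoc l y e)) ee≈e) lq≈0) (+-identityʳ e))
                    (trans (+-cong pye≈0 pq≈j) (+-identityˡ j)) ⟩
        e + j                                    ≈⟨ ly+j≈1 ⟩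
        1#                                       ∎
        where
        pye≈0 : p * (y * e) ≈ 0#
        pye≈0 = begin
          p * (y * e)        ≈⟨ *-congˡ (trans ye≈ey (*-assoc l y y)) ⟩
          p * (l * (y * y))  ≈⟨ *-assoc p l (y * y) ⟨
          p * l * (y * y)    ≈⟨ *-congʳ pl≈0 ⟩
          0# * (y * y)       ≈⟨ zeroˡ _ ⟩
          0#                 ∎

      yel≈e : y * e * l ≈ e
      yel≈e = trans (*-assoc y e l) (trans (*-congˡ el≈l) (sym ly≈yl))

      inverseˡ : z * (l + p) ≈ 1#
      inverseˡ = begin
        z * (l + p)                              ≈⟨ distribˡ z l p ⟩
        z * l + z * p                            ≈⟨ +-cong (distribʳ l (y * e) q) (distribʳ p (y * e) q) ⟩
        y * e * l + q * l + (y * e * p + q * p)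
          ≈⟨ +-cong (trans (+-cong yel≈e ql≈0) (+-identityʳ e))
                    (trans (+-cong yep≈0 qp≈j) (+-identityˡ j)) ⟩
        e + j                                    ≈⟨ ly+j≈1 ⟩
        1#                                       ∎
        where
        yep≈0 : y * e * p ≈ 0#
        yep≈0 = begin
          y * e * p          ≈⟨ *-congʳ (*-congˡ ly≈yl) ⟩
          y * (y * l) * p    ≈⟨ *-congʳ (*-assoc y y l) ⟨
          y * y * l * p      ≈⟨ *-assoc (y * y) l p ⟩
          y * y * (l * p)    ≈⟨ *-congˡ lp≈0 ⟩
          y * y * 0#         ≈⟨ zeroʳ _ ⟩
          0#                 ∎

      -- Subtracting `q` removes all dependence on α, so the remaining identities concern `y * e`
      -- alone.
      x≈ye : z - q ≈ y * e
      x≈ye = trans (+-assoc (y * e) q (- q)) (trans (+-congˡ (-‿inverseʳ q)) (+-identityʳ _))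

      lx≈e : l * (z - q) ≈ e
      lx≈e = trans (*-congˡ x≈ye) (trans (sym (*-assoc l y e)) ee≈e)

      xl≈e : (z - q) * l ≈ e
      xl≈e = trans (*-congʳ x≈ye) yel≈e

      lxl≈l : l * (z - q) * l ≈ l
      lxl≈l = trans (*-congʳ lx≈e) el≈l

      xlx≈x : (z - q) * l * (z - q) ≈ z - q
      xlx≈x = begin
        (z - q) * l * (z - q)  ≈⟨ *-cong xl≈e x≈ye ⟩
        e * (y * e)            ≈⟨ *-assoc e y e ⟨
        e * y * e              ≈⟨ *-congʳ ye≈ey ⟨
        y * e * e              ≈⟨ *-assoc y e e ⟩
        y * (e * e)            ≈⟨ *-congˡ ee≈e ⟩
        y * e                  ≈⟨ x≈ye ⟨
        z - q                  ∎

-- The Kirchhoff matrix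

module MatrixRing {c ℓ₁ ℓ₂ ℓ₃} (F : OrderedField c ℓ₁ ℓ₂ ℓ₃) (n : ℕ) where
  open OrderedField F
  open Sums F
  open Matrices F
  open import Relation.Binary.Reasoning.Setoid setoid

  ∑-δˡ : ∀ i (f : Fin n → Carrier) → (∑ λ k → 𝟙 i k * f k) ≈ f i
  ∑-δˡ i f = trans (sum-cong-≋ {n} pointwise) (sum-δ +-commutativeMonoid i (f i))
    where
    pointwise : ∀ k → 𝟙 i k * f k ≈ (if does (k ≟ i) then f i else 0#)
    pointwise k with i ≟ k | k ≟ i
    ... | yes ≡.refl | yes _      = *-identityˡ _
    ... | no _       | no _       = zeroˡ _
    ... | yes ≡.refl | no i≢i     = ⊥-elim (i≢i ≡.refl)
    ... | no i≢i     | yes ≡.refl = ⊥-elim (i≢i ≡.refl)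

  𝟙-sym : ∀ i j → 𝟙 {n} i j ≈ 𝟙 j i
  𝟙-sym i j with i ≟ j | j ≟ i
  ... | yes _      | yes _      = refl
  ... | no _       | no _       = refl
  ... | yes ≡.refl | no i≢i     = ⊥-elim (i≢i ≡.refl)
  ... | no i≢i     | yes ≡.refl = ⊥-elim (i≢i ≡.refl)

  ⊛-assoc : (A B C : Matrix n) → (A ⊛ B) ⊛ C ≋ A ⊛ (B ⊛ C)
  ⊛-assoc A B C i j = begin
    (∑ λ k → (∑ λ m → A i m * B m k) * C k j)
      ≈⟨ sum-cong-≋ {n} (λ k → trans (*-distribʳ-sum {n} (C k j) _)
           (sum-cong-≋ {n} λ m → *-assoc _ _ _)) ⟩
    (∑ λ k → ∑ λ m → A i m * (B m k * C k j))
      ≈⟨ ∑-comm {n} {n} _ ⟩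
    (∑ λ m → ∑ λ k → A i m * (B m k * C k j))
      ≈⟨ sum-cong-≋ {n} (λ m → sym (*-distribˡ-sum {n} (A i m) _)) ⟩
    (∑ λ m → A i m * (∑ λ k → B m k * C k j)) ∎

  matrixRing : Ring c ℓ₁
  matrixRing = record
    { Carrier = Matrix n
    ; _≈_     = _≋_
    ; _+_     = _⊕_
    ; _*_     = _⊛_
    ; -_      = λ A i j → - A i j
    ; 0#      = λ _ _ → 0#
    ; 1#      = 𝟙
    ; isRing  = record
      { +-isAbelianGroup = record
        { isGroup = record
          { isMonoid = record
            { isSemigroup = record
              { isMagma = record
                { isEquivalence = record
                  { refl  = λ _ _ → refl
                  ; sym   = λ p i j → sym (p i j)
                  ; trans = λ p q i j → trans (p i j) (q i j)
                  }
                ; ∙-cong = λ p q i j → +-cong (p i j) (q i j)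
                }
              ; assoc = λ _ _ _ _ _ → +-assoc _ _ _
              }
            ; identity = (λ _ _ _ → +-identityˡ _) , (λ _ _ _ → +-identityʳ _)
            }
          ; inverse = (λ _ _ _ → -‿inverseˡ _) , (λ _ _ _ → -‿inverseʳ _)
          ; ⁻¹-cong = λ p i j → -‿cong (p i j)
          }
        ; comm = λ _ _ _ _ → +-comm _ _
        }
      ; *-cong     = λ p q i j → sum-cong-≋ {n} λ k → *-cong (p i k) (q k j)
      ; *-assoc    = ⊛-assoc
      ; *-identity = (λ A i j → ∑-δˡ i (λ k → A k j)) ,
        (λ A i j → trans (sum-cong-≋ {n} λ k → trans (*-comm _ _) (*-congʳ (𝟙-sym k j)))
                         (∑-δˡ j (A i)))
      ; distrib    =
        (λ A B C i j → trans (sum-cong-≋ {n} λ k → distribˡ _ _ _) (∑-distrib-+ {n} _ _)) ,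
        (λ A B C i j → trans (sum-cong-≋ {n} λ k → distribʳ _ _ _) (∑-distrib-+ {n} _ _))
      }
    }

  ·-⊛ : ∀ a (A B : Matrix n) → (a · A) ⊛ B ≋ a · (A ⊛ B)
  ·-⊛ a A B i j = trans (sum-cong-≋ {n} λ k → *-assoc _ _ _) (sym (*-distribˡ-sum {n} a _))

  ⊛-· : ∀ a (A B : Matrix n) → A ⊛ (a · B) ≋ a · (A ⊛ B)
  ⊛-· a A B i j = trans
    (sum-cong-≋ {n} λ k → trans (sym (*-assoc _ _ _)) (trans (*-congʳ (*-comm _ _)) (*-assoc _ _ _)))
    (sym (*-distribˡ-sum {n} a _))

module Kirchhoff {c ℓ₁ ℓ₂ ℓ₃} (F : OrderedField c ℓ₁ ℓ₂ ℓ₃) {n} (Γ : WeightedDigraph F n) where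
  open OrderedField F
  open Sums F
  open Matrices F
  open WeightedDigraph Γ
  open Forests F Γ
  open MatrixRing F n
  open RingProperties ring using (+-cancelʳ)
  module M = Ring matrixRing
  open import Relation.Binary.Reasoning.Setoid setoid

  L J : Matrix n
  L = kirchhoff Γ
  J = J̄ Γ

  -- The Kirchhoff matrix is the diagonal matrix of weighted indegrees minus the transposed weight
  -- matrix. Its diagonal sum omits `k = i`, the full sum does not; looplessness reconciles them.
  L+weight : ∀ i k → L i k + weight k i ≈ (if does (k ≟ i) then (∑ λ m → weight m i) else 0#)
  L+weight i k with i ≟ k | k ≟ i
  ... | yes ≡.refl | no i≢i     = ⊥-elim (i≢i ≡.refl)
  ... | no i≢i     | yes ≡.refl = ⊥-elim (i≢i ≡.refl)
  ... | no _       | no _       = -‿inverseˡ _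
  ... | yes ≡.refl | yes _      = begin
    - ∑ off + weight i i                      ≈⟨ trans (+-congˡ (weight-0 (loopless i))) (+-identityʳ _) ⟩
    - ∑ off                                   ≈⟨ +-identityʳ _ ⟨
    - ∑ off + 0#                              ≈⟨ +-congˡ off+weight ⟨
    - ∑ off + (∑ off + ∑ (λ m → weight m i))  ≈⟨ +-assoc _ _ _ ⟨
    - ∑ off + ∑ off + ∑ (λ m → weight m i)    ≈⟨ +-congʳ (-‿inverseˡ _) ⟩
    0# + ∑ (λ m → weight m i)                 ≈⟨ +-identityˡ _ ⟩
    ∑ (λ m → weight m i)                      ∎
    where
    off : Fin n → Carrier
    off m = if does (i ≟ m) then 0# else - weight m i
    cancel : ∀ m → off m + weight m i ≈ 0#
    cancel m with i ≟ m
    ... | yes ≡.refl = trans (+-identityˡ _) (weight-0 (loopless i))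
    ... | no _       = -‿inverseˡ _
    off+weight : ∑ off + ∑ (λ m → weight m i) ≈ 0#
    off+weight = trans (sym (∑-distrib-+ {n} off _))
      (trans (sum-cong-≋ {n} cancel) (sum-replicate-zero n))

  L⊛+ : ∀ A i j → (L ⊛ A) i j + (∑ λ m → weight m i * A m j) ≈ (∑ λ m → weight m i) * A i j
  L⊛+ A i j = begin
    (L ⊛ A) i j + (∑ λ m → weight m i * A m j)
      ≈⟨ ∑-distrib-+ {n} _ _ ⟨
    (∑ λ m → L i m * A m j + weight m i * A m j)
      ≈⟨ sum-cong-≋ {n} pointwise ⟩
    (∑ λ m → if does (m ≟ i) then (∑ λ m → weight m i) * A i j else 0#)
      ≈⟨ sum-δ +-commutativeMonoid i _ ⟩
    (∑ λ m → weight m i) * A i j ∎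
    where
    select : ∀ m (m≟i : Dec (m ≡ i)) {x} →
      (if does m≟i then x else 0#) * A m j ≈ (if does m≟i then x * A i j else 0#)
    select m (yes ≡.refl) = refl
    select m (no _)       = zeroˡ _
    pointwise : ∀ m → L i m * A m j + weight m i * A m j ≈
                      (if does (m ≟ i) then (∑ λ m → weight m i) * A i j else 0#)
    pointwise m = trans (sym (distribʳ _ _ _))
      (trans (*-congʳ (L+weight i m)) (select m (m ≟ i)))

  Q⊕L⊛Q : ∀ κ → Q κ ⊕ L ⊛ Q (κ ∘ suc) ≋ σ κ · 𝟙
  Q⊕L⊛Q κ i j = +-cancelʳ (∑ λ m → weight m i * Q (κ ∘ suc) m j) _ _ (begin
    Q κ i j + (L ⊛ Q (κ ∘ suc)) i j + (∑ λ m → weight m i * Q (κ ∘ suc) m j)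
      ≈⟨ trans (+-assoc _ _ _) (+-congˡ (L⊛+ (Q (κ ∘ suc)) i j)) ⟩
    Q κ i j + (∑ λ m → weight m i) * Q (κ ∘ suc) i j
      ≈⟨ Splitting.recurrence i κ j ⟩
    σ κ * 𝟙 i j + (∑ λ m → weight m i * Q (κ ∘ suc) m j) ∎)

  Q≋0 : ∀ κ → (∀ G → φ κ G ≈ 0#) → Q κ ≋ M.0#
  Q≋0 κ φ≈0 i j = ∑∈-0 (digraphs n) λ G → trans (*-congʳ (φ≈0 G)) (zeroˡ _)

  δ : ℕ → ℕ → Carrier
  δ k m = χ (m ℕₚ.≟ k)

  -- `δ k ∘ suc` selects the forests with `k - 1` arcs, which is the index needed for `Y` and makes
  -- the induction start from the zero matrix.
  L⊛Q≋Q⊛L : ∀ k → L ⊛ Q (δ k ∘ suc) ≋ Q (δ k ∘ suc) ⊛ L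
  L⊛Q≋Q⊛L zero = M.trans (M.trans (M.*-congˡ {x = L} Q≋0′) (M.zeroʳ L))
    (M.sym (M.trans (M.*-congʳ {x = L} Q≋0′) (M.zeroˡ L)))
    where
    Q≋0′ : Q (λ _ → 0#) ≋ M.0#
    Q≋0′ = Q≋0 _ λ G → trans (*-congˡ (zeroˡ _)) (zeroʳ _)
  -- `δ (suc k) ∘ suc` reduces to `δ k`, so the goal concerns the first matrix of the recurrence for
  -- `δ k`.
  L⊛Q≋Q⊛L (suc k) = commutes-step matrixRing (Q⊕L⊛Q (δ k))
    (M.trans (⊛-· (σ (δ k)) L 𝟙) (M.trans
      (λ i j → *-congˡ (M.trans (M.*-identityʳ L) (M.sym (M.*-identityˡ L)) i j))
      (M.sym (·-⊛ (σ (δ k)) 𝟙 L))))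
    (L⊛Q≋Q⊛L k)

  private
    G₀ = proj₁ (maximumOutForest-exists digraph)
    K = numArcs G₀
    total = totalWeight Γ (maximumOutForests digraph)
    r = recip total (pos⇒#0 (maximumOutForests-weight-pos Γ))

  G₀-isMaximum : IsMaximumOutForest digraph G₀
  G₀-isMaximum = proj₂ (∈-filter⁻ (isMaximumOutForest? digraph) {xs = digraphs n}
    (proj₂ (maximumOutForest-exists digraph)))

  -- Since one maximum out forest `G₀` is at hand, comparing with all out forests reduces to
  -- counting arcs; this identifies `σ (δ K)` and `Q (δ K)` with the weights that define `J`.
  χ-maximum : ∀ G → χ (isMaximumOutForest? digraph G) ≈ χ (isOutForest? digraph G) * δ K (numArcs G)
  χ-maximum G = χ-× (isMaximumOutForest? digraph G) (isOutForest? digraph G) (numArcs G ℕₚ.≟ K)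
    (λ (forest , max) → forest ,
      ℕₚ.≤-antisym (proj₂ G₀-isMaximum G forest) (max G₀ (proj₁ G₀-isMaximum)))
    (λ (forest , G≡K) → forest , λ G′ forest′ →
      ≡.subst (numArcs G′ ℕ.≤_) (≡.sym G≡K) (proj₂ G₀-isMaximum G′ forest′))

  σ≈total : σ (δ K) ≈ total
  σ≈total = sym (trans (∑∈-filter (isMaximumOutForest? digraph) (digraphs n) _)
    (∑∈-cong (digraphs n) λ G → trans (*-congʳ (χ-maximum G)) (*-assoc _ _ _)))

  Q≈totalRootedAt : ∀ i j → Q (δ K) i j ≈ totalWeight Γ (maximumOutForestsRootedAt digraph i j)
  Q≈totalRootedAt i j = sym (trans (∑∈-filter (inTreeRootedAt? i j) (maximumOutForests digraph) _)
    (trans (∑∈-filter (isMaximumOutForest? digraph) (digraphs n) _)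
    (∑∈-cong (digraphs n) λ G → trans (*-cong (χ-maximum G) (*-comm _ _))
      (trans (sym (*-assoc _ _ _)) (*-congʳ (*-assoc _ _ _))))))

  φ-too-many : ∀ G → φ (δ (suc K)) G ≈ 0#
  φ-too-many G = trans
    (χ-* (isOutForest? digraph G) λ forest → trans
      (*-congʳ (χ-no (numArcs G ℕₚ.≟ suc K) λ G≡1+K →
        ℕₚ.1+n≰n (≡.subst (ℕ._≤ K) G≡1+K (proj₂ G₀-isMaximum G forest))))
      (zeroˡ _))
    (zeroʳ _)

  J≋rQ : J ≋ r · Q (δ K)
  J≋rQ i j = trans (*-congʳ (sym (Q≈totalRootedAt i j))) (*-comm _ _)

  -- If `K` is 0, this is the zero matrix, and `J` is then the identity.
  Y : Matrix n
  Y = r · Q (δ K ∘ suc)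

  L⊛Y⊕J : L ⊛ Y ⊕ J ≋ 𝟙
  L⊛Y⊕J i j = begin
    (L ⊛ Y) i j + J i j
      ≈⟨ +-cong (⊛-· r L (Q (δ K ∘ suc)) i j) (J≋rQ i j) ⟩
    r * (L ⊛ Q (δ K ∘ suc)) i j + r * Q (δ K) i j
      ≈⟨ trans (+-comm _ _) (sym (distribˡ r _ _)) ⟩
    r * (Q (δ K) i j + (L ⊛ Q (δ K ∘ suc)) i j)
      ≈⟨ *-congˡ (trans (Q⊕L⊛Q (δ K) i j) (*-congʳ σ≈total)) ⟩
    r * (total * 𝟙 i j)
      ≈⟨ *-assoc _ _ _ ⟨
    r * total * 𝟙 i j
      ≈⟨ *-congʳ (trans (*-comm _ _) (recip-inverseʳ total _)) ⟩
    1# * 𝟙 i j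
      ≈⟨ *-identityˡ _ ⟩
    𝟙 i j ∎

  L⊛Q≋0 : L ⊛ Q (δ K) ≋ M.0#
  L⊛Q≋0 i j = begin
    (L ⊛ Q (δ K)) i j
      ≈⟨ trans (+-congʳ (Q≋0 (δ (suc K)) φ-too-many i j)) (+-identityˡ _) ⟨
    Q (δ (suc K)) i j + (L ⊛ Q (δ K)) i j
      -- The recurrence one step above the maximum, where `δ (suc K) ∘ suc` reduces to `δ K`.
      ≈⟨ Q⊕L⊛Q (δ (suc K)) i j ⟩
    σ (δ (suc K)) * 𝟙 i j
      ≈⟨ trans (*-congʳ (∑∈-0 (digraphs n) φ-too-many)) (zeroˡ _) ⟩
    0# ∎

  L⊛J≋0 : L ⊛ J ≋ M.0#
  L⊛J≋0 = M.trans (M.*-congˡ {x = L} J≋rQ) (M.trans (⊛-· r L (Q (δ K)))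
    λ i j → trans (*-congˡ (L⊛Q≋0 i j)) (zeroʳ r))

  L⊛Y≋Y⊛L : L ⊛ Y ≋ Y ⊛ L
  L⊛Y≋Y⊛L = M.trans (⊛-· r L (Q (δ K ∘ suc))) (M.trans
    (λ i j → *-congˡ (L⊛Q≋Q⊛L K i j))
    (M.sym (·-⊛ r (Q (δ K ∘ suc)) L)))

theorem11 :
    ∀ {c ℓ₁ ℓ₂ ℓ₃} (F : OrderedField c ℓ₁ ℓ₂ ℓ₃) →
    let open OrderedField F
        open Matrices F
    in
    (n : ℕ) → 1 ℕ.< n →
    (Γ : WeightedDigraph F n) →
    (α : Carrier) (α#0 : α # 0#) →
    let L = kirchhoff Γ
        J = J̄ Γ
    in
    Σ[ inv ∈ Invertible (L ⊕ α · J) ]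
      let L# = proj₁ inv ⊖ recip α α#0 · J in
      IsGroupInverse L L# × (L# ⊛ L ≋ 𝟙 ⊖ J) × (L ⊛ L# ≋ 𝟙 ⊖ J)
theorem11 F n _ Γ α α#0 =
  (z , inverseˡ , inverseʳ) ,
  record { AXA≋A = lxl≈l ; XAX≋X = xlx≈x ; AX≋XA = M.trans lx≈e (M.sym xl≈e) } ,
  M.trans xl≈e e≈1-j ,
  M.trans lx≈e e≈1-j
  where
  open OrderedField F
  open Matrices F
  open MatrixRing F n
  open Kirchhoff F Γ
  open GroupInverse matrixRing L⊛Y⊕J L⊛J≋0 L⊛Y≋Y⊛L
  module R = CommutativeRing commutativeRing

  β : Carrier
  β = recip α α#0

  L⊛·J≋0 : ∀ a → L ⊛ (a · J) ≋ M.0#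
  L⊛·J≋0 a = M.trans (⊛-· a L J) (λ i j → trans (*-congˡ (L⊛J≋0 i j)) (R.zeroʳ a))

  ·J⊛L≋0 : ∀ a → (a · J) ⊛ L ≋ M.0#
  ·J⊛L≋0 a = M.trans (·-⊛ a J L) (λ i j → trans (*-congˡ (jl≈0 i j)) (R.zeroʳ a))

  ·J⊛·J≋J : ∀ a b → a * b ≈ 1# → (a · J) ⊛ (b · J) ≋ J
  ·J⊛·J≋J a b ab≈1 = M.trans (·-⊛ a J (b · J)) λ i j → trans
    (*-congˡ (trans (⊛-· b J J i j) (*-congˡ (jj≈j i j))))
    (trans (sym (*-assoc a b _)) (trans (*-congʳ ab≈1) (*-identityˡ _)))

  -- Here `p` is `α · J` and `q` is `β · J`; by idempotence of `J` their products are `J` in either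
  -- order.
  open ShiftedInverse (L⊛·J≋0 α) (·J⊛L≋0 α) (L⊛·J≋0 β) (·J⊛L≋0 β)
    (·J⊛·J≋J α β (recip-inverseʳ α α#0)) (·J⊛·J≋J β α (trans (*-comm β α) (recip-inverseʳ α α#0)))
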